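{- Let $$A=\sum_{n\ge 0}t^n\sum_{\sigma\in\mathcal S_n(123)}y^{\mathrm{des}(\sigma)}x_1^{231\text{ -mch}(\sigma)}x_2^{132\text{ -mch}(\sigma)}x_3^{321\text{ -mch}(\sigma)} ,$$ and let $A_0$ be the formal power series in $t$ (with coefficients in $\mathbb Q[y,x_1,x_2,x_3]$) determined by $$A_0=1+ t x_3 y A_0 + t^2 x_1 y A_0^2 + \frac{ t^3 x_2 x_3 y^2 A_0^3}{1 - t x_3 y A_0}.$$ Then $A=N/D$, where $$D=x_3 (x_1-x_2)\Big(A_0 x_3^2t^2 y^2 (A_0 t^2 y(x_1-x_2)-1)-(A_0+1) x_3 t y(A_0 t^2 y (x_1-x_2)-1)+A_0x_1 t^2 y-1\Big)$$ and $$\begin{aligned} N={}&x_1 \Big(x_3^2 t y \big(A_0^2 t^2(x_2 t^2 y^2+y (3 x_2 t+2x_2+t+1)+1)+A_0 ((x_2+1) t^3 y+t^2 (2x_2 y+y+2)+t+1)+t+1\big)\\ &\quad+x_2 t^2 (-A_0^2t y+A_0-1)+A_0^2 x_3^4 t^5 y^3\\ &\quad-A_0x_3^3 t^2 y^2 \big(A_0 (x_2+1) t^3 y+t^2 (A_0(2 x_2 y+y+2)+1)+t+1\big)\\ &\quad+x_3 \big(A_0 x_2t^4 y (A_0-y)-A_0 t^3 y (A_0x_2+x_2+1)-A_0 t^2 (x_2y+y+1)-t-1\big)\Big)\\ &+x_2 \Big(-A_0^2 x_3^4 t^5y^3-x_3^2 t y \big(A_0^2 (2 t-1) t^2 y+A_0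 (t^3y+t^2 (y+2)+t+1)+t+1\big)\\ &\quad+x_3 \big(t^2 (-A_0^2y+y+1)+A_0 (A_0+1) t^3 y+t+1\big)\\ &\quad+A_0x_3^3 t^2 y^2 \big(A_0 t^3 y+(A_0+1)t^2+t+1\big)+(A_0-1) t\Big)\\ &+x_3 t (x_3 t y-1)\big(A_0^2 x_3 t y (x_3 ty-1)+A_0-1\big)\\ &+A_0 x_1^2 t^2 y \big(-A_0x_2 t^2+A_0 x_3^3 t^2 y^2-(A_0+1) x_3^2 ty+x_3\big)\\ &+A_0 x_2^2 x_3 t^3 y\big(A_0 x_3^2 t (t+1) y^2-x_3 y (A_0 t^2y+2 A_0 t+A_0+t+1)+(A_0+1) ty+1\big). \end{aligned}$$
   Context: $\mathcal S_n$ is the set of permutations of $\{1,\dots,n\}$ in one-line notation ($\mathcal S_0$ contains only the empty permutation, on which all statistics are $0$). For a word $w$ of distinct integers, $\mathrm{red}(w)$ replaces the $i$-th smallest letter by $i$. $\sigma\in\mathcal S_n$ avoids $\lambda\in\mathcal S_k$ (classical avoidance) if no (not necessarily contiguous) subsequence $\sigma_{i_1}\cdots\sigma_{i_k}$, $i_1<\dots<i_k$, has reduction $\lambda$; $\mathcal S_n(\lambda)$ is the set of such $\sigma$. $\gamma\text{ -mch}(\sigma)$ is the number of $i$ with $\mathrm{red}(\sigma_i\sigma_{i+1}\cdots\sigma_{i+k-1})=\gamma$ for $\gamma\in\mathcal S_k$. $\mathrm{des}(\sigma)=|\{i:\sigma_i>\sigma_{i+1}\}|$. The identity $A=N/D$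 is in the fraction field of $\mathbb Q[y,x_1,x_2,x_3][[t]]$. -}

module Defs where

open import Algebra.Bundles.Raw using (RawRing)
import Algebra.Definitions.RawMonoid as RawMonoidDefs
import Algebra.Definitions.RawSemiring as RawSemiringDefs
open import Data.Fin.Base using (toℕ)
open import Data.List.Base
  using (List; []; _∷_; _++_; map; filter; foldr; length; upTo; take; drop; tails; zip;
         cartesianProductWith)
open import Data.List.Properties using (≡-dec)
open import Data.List.Relation.Unary.Any using (Any; any?)
open import Data.Nat.Base as ℕ using (ℕ; zero; suc; _∸_)
import Data.Nat.Properties as ℕ
open import Data.List.Relation.Unary.Unique.DecPropositional ℕ._≟_ using (unique?)
open import Data.Product.Base using (Σ-syntax; _×_; _,_)
open import Data.Rational.Base using () renaming (+-*-rawRing to ℚ-rawRing)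
open import Level using (0ℓ)
open import Relation.Binary.PropositionalEquality.Core using (_≡_)
open import Relation.Nullary.Decidable using (¬?)
open import Relation.Nullary.Negation using (¬_)
open import Relation.Unary using (Decidable)

------------------------------------------------------------------------
-- Words and permutations

Word : Set
Word = List ℕ

words : List ℕ → ℕ → List Word
words as zero    = [] ∷ []
words as (suc k) = cartesianProductWith _∷_ as (words as k)

-- One-line notation: the words of length n in the letters 1, …, n without
-- repeated letter.
permutations : ℕ → List Word
permutations n = filter unique? (words (map suc (upTo n)) n)

-- For a word of distinct letters, the i-th smallest letter is the one that has
-- exactly i letters less than or equal to it.
red : Word → Word
red w = map (λ a → length (filter (ℕ._≤? a) w)) w

subsequences : Word → List Word
subsequences []      = [] ∷ []
subsequences (a ∷ w) = map (a ∷_) (subsequences w) ++ subsequences w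

Avoids : Word → Word → Set
Avoids τ σ = ¬ Any (λ w → red w ≡ τ) (subsequences σ)

avoids? : ∀ τ → Decidable (Avoids τ)
avoids? τ σ = ¬? (any? (λ w → ≡-dec ℕ._≟_ (red w) τ) (subsequences σ))

avoiders : Word → ℕ → List Word
avoiders τ n = filter (avoids? τ) (permutations n)

des : Word → ℕ
des σ = length (filter (λ { (a , b) → b ℕ.<? a }) (zip σ (drop 1 σ)))

-- A suffix shorter than γ contributes nothing, since red preserves length.
mch : Word → Word → ℕ
mch γ σ = length (filter (λ s → ≡-dec ℕ._≟_ (red (take (length γ) s)) γ) (tails σ))

------------------------------------------------------------------------
-- Polynomials over R: lists of coefficients, constant term first, compared
-- coefficientwise (so trailing zeros are immaterial).

module Polynomial {c ℓ} (R : RawRing c ℓ) where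
  open RawRing R

  coeff : List Carrier → ℕ → Carrier
  coeff []      _       = 0#
  coeff (a ∷ p) zero    = a
  coeff (a ∷ p) (suc i) = coeff p i

  add : List Carrier → List Carrier → List Carrier
  add []      q       = q
  add (a ∷ p) []      = a ∷ p
  add (a ∷ p) (b ∷ q) = (a + b) ∷ add p q

  mul : List Carrier → List Carrier → List Carrier
  mul []      q = []
  mul (a ∷ p) q = add (map (a *_) q) (0# ∷ mul p q)

  rawRing : RawRing c ℓ
  rawRing = record
    { Carrier = List Carrier
    ; _≈_     = λ p q → ∀ i → coeff p i ≈ coeff q i
    ; _+_     = add
    ; _*_     = mul
    ; -_      = map (-_)
    ; 0#      = []
    ; 1#      = 1# ∷ []
    }

  const : Carrier → List Carrier
  const a = a ∷ []

  X : List Carrier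
  X = 0# ∷ 1# ∷ []

------------------------------------------------------------------------
-- Formal power series over R: sequences of coefficients

module PowerSeries {c ℓ} (R : RawRing c ℓ) where
  open RawRing R
  open RawMonoidDefs +-rawMonoid using (sum)

  const : Carrier → ℕ → Carrier
  const a zero    = a
  const a (suc _) = 0#

  X : ℕ → Carrier
  X (suc zero) = 1#
  X _          = 0#

  rawRing : RawRing c ℓ
  rawRing = record
    { Carrier = ℕ → Carrier
    ; _≈_     = λ f g → ∀ n → f n ≈ g n
    ; _+_     = λ f g n → f n + g n
    ; _*_     = λ f g n → sum {suc n} (λ i → f (toℕ i) * g (n ∸ toℕ i))
    ; -_      = λ f n → - f n
    ; 0#      = const 0#
    ; 1#      = const 1#
    }

------------------------------------------------------------------------
-- ℚ[y,x₁,x₂,x₃], as ℚ[y][x₁][x₂][x₃], and the weight of a permutation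

module ℚ[y]          = Polynomial ℚ-rawRing
module ℚ[y,x₁]       = Polynomial ℚ[y].rawRing
module ℚ[y,x₁,x₂]    = Polynomial ℚ[y,x₁].rawRing
module ℚ[y,x₁,x₂,x₃] = Polynomial ℚ[y,x₁,x₂].rawRing

module Coefficients where
  open RawRing ℚ[y,x₁,x₂,x₃].rawRing public
  open RawSemiringDefs rawSemiring public using (_^_)

  y x₁ x₂ x₃ : Carrier
  y  = ℚ[y,x₁,x₂,x₃].const (ℚ[y,x₁,x₂].const (ℚ[y,x₁].const ℚ[y].X))
  x₁ = ℚ[y,x₁,x₂,x₃].const (ℚ[y,x₁,x₂].const ℚ[y,x₁].X)
  x₂ = ℚ[y,x₁,x₂,x₃].const ℚ[y,x₁,x₂].X
  x₃ = ℚ[y,x₁,x₂,x₃].X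

  weight : Word → Carrier
  weight σ = y ^ des σ
           * x₁ ^ mch (2 ∷ 3 ∷ 1 ∷ []) σ
           * x₂ ^ mch (1 ∷ 3 ∷ 2 ∷ []) σ
           * x₃ ^ mch (3 ∷ 2 ∷ 1 ∷ []) σ

------------------------------------------------------------------------
-- ℚ[y,x₁,x₂,x₃][[t]]

module Series = PowerSeries ℚ[y,x₁,x₂,x₃].rawRing

open RawRing Series.rawRing public
open RawSemiringDefs rawSemiring public using (_^_) renaming (_×_ to _·_)

infixl 6 _-_
_-_ : Carrier → Carrier → Carrier
f - g = f + (- g)

-- f = a / b in the fraction field of the ring of power series
-- (an integral domain).
infix 4 _≈_÷_
_≈_÷_ : Carrier → Carrier → Carrier → Set
f ≈ a ÷ b = b ≉ 0# × f * b ≈ a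

y x₁ x₂ x₃ t : Carrier
y  = Series.const Coefficients.y
x₁ = Series.const Coefficients.x₁
x₂ = Series.const Coefficients.x₂
x₃ = Series.const Coefficients.x₃
t  = Series.X

A : Carrier
A n = foldr Coefficients._+_ Coefficients.0#
        (map Coefficients.weight (avoiders (1 ∷ 2 ∷ 3 ∷ []) n))

IsA₀ : Carrier → Set
IsA₀ A₀ = Σ[ Q ∈ Carrier ]
    Q ≈ t ^ 3 * x₂ * x₃ * y ^ 2 * A₀ ^ 3 ÷ (1# - t * x₃ * y * A₀)
  × A₀ ≈ 1# + t * x₃ * y * A₀ + t ^ 2 * x₁ * y * A₀ ^ 2 + Q

D : Carrier → Carrier
D A₀ =
  x₃ * (x₁ - x₂)
  * ( A₀ * x₃ ^ 2 * t ^ 2 * y ^ 2 * (A₀ * t ^ 2 * y * (x₁ - x₂) - 1#)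
    - (A₀ + 1#) * x₃ * t * y * (A₀ * t ^ 2 * y * (x₁ - x₂) - 1#)
    + A₀ * x₁ * t ^ 2 * y - 1#)

N : Carrier → Carrier
N A₀ =
  x₁
  * ( x₃ ^ 2 * t * y
      * ( A₀ ^ 2 * t ^ 2
          * (x₂ * t ^ 2 * y ^ 2 + y * (3 · x₂ * t + 2 · x₂ + t + 1#) + 1#)
        + A₀ * ((x₂ + 1#) * t ^ 3 * y + t ^ 2 * (2 · x₂ * y + y + 2 · 1#) + t + 1#)
        + t + 1#)
    + x₂ * t ^ 2 * (- (A₀ ^ 2 * t * y) + A₀ - 1#)
    + A₀ ^ 2 * x₃ ^ 4 * t ^ 5 * y ^ 3
    - A₀ * x₃ ^ 3 * t ^ 2 * y ^ 2
      * ( A₀ * (x₂ + 1#) * t ^ 3 * y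
        + t ^ 2 * (A₀ * (2 · x₂ * y + y + 2 · 1#) + 1#) + t + 1#)
    + x₃
      * ( A₀ * x₂ * t ^ 4 * y * (A₀ - y)
        - A₀ * t ^ 3 * y * (A₀ * x₂ + x₂ + 1#)
        - A₀ * t ^ 2 * (x₂ * y + y + 1#) - t - 1#))
  + x₂
    * ( - (A₀ ^ 2 * x₃ ^ 4 * t ^ 5 * y ^ 3)
      - x₃ ^ 2 * t * y
        * ( A₀ ^ 2 * (2 · t - 1#) * t ^ 2 * y
          + A₀ * (t ^ 3 * y + t ^ 2 * (y + 2 · 1#) + t + 1#) + t + 1#)
      + x₃
        * ( t ^ 2 * (- (A₀ ^ 2 * y) + y + 1#)
          + A₀ * (A₀ + 1#) * t ^ 3 * y + t + 1#)
      + A₀ * x₃ ^ 3 * t ^ 2 * y ^ 2 * (A₀ * t ^ 3 * y + (A₀ + 1#) * t ^ 2 + t + 1#)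
      + (A₀ - 1#) * t)
  + x₃ * t * (x₃ * t * y - 1#) * (A₀ ^ 2 * x₃ * t * y * (x₃ * t * y - 1#) + A₀ - 1#)
  + A₀ * x₁ ^ 2 * t ^ 2 * y
    * ( - (A₀ * x₂ * t ^ 2) + A₀ * x₃ ^ 3 * t ^ 2 * y ^ 2
      - (A₀ + 1#) * x₃ ^ 2 * t * y + x₃)
  + A₀ * x₂ ^ 2 * x₃ * t ^ 3 * y
    * ( A₀ * x₃ ^ 2 * t * (t + 1#) * y ^ 2
      - x₃ * y * (A₀ * t ^ 2 * y + 2 · A₀ * t + A₀ + t + 1#)
      + (A₀ + 1#) * t * y + 1#)

{-# OPTIONS --safe #-}

-- Read a 123-avoiding permutation from left to right. A letter is either a new
-- left-to-right minimum (m) or the largest unused letter (n), so only the number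
-- of unused letters above the current minimum, the height, matters: an m raises
-- it by an arbitrary amount, an n lowers it by one. The types of consecutive
-- letters determine all the statistics: mnm is 231, mnn is 132, the triples
-- □mm, nnm, nnn are 321, the others contribute nothing, and every pair but mn
-- is a descent.
--
-- Marking the height by u in the generating functions of the completions of a
-- prefix gives a linear system whose kernel is, after clearing the denominator,
-- the equation defining A₀ at u = A₀. Substituting u = A₀ therefore yields the
-- generating function at height 0, and substituting u = 1 then yields A. Both
-- substitutions make sense because height b needs at least b further letters,
-- i.e. the coefficient of u^b is O(t^b).
module Submission where

open import Algebra.Bundles using (CommutativeRing)
open import Algebra.Bundles.Raw using (RawRing)
import Algebra.Morphism.RingMonomorphism as RingMonomorphism
open import Algebra.Morphism.Structures using (IsRingMonomorphism)
import Algebra.Properties.AbelianGroup as AbelianGroupProperties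
import Algebra.Properties.CommutativeSemigroup as CommutativeSemigroupProperties
import Algebra.Properties.Monoid.Mult.TCOptimised as MonoidMult
import Algebra.Properties.Ring as RingProperties
import Algebra.Properties.Semiring.Exp as Exp
import Algebra.Properties.Semiring.Mult.TCOptimised as SemiringMult
import Algebra.Solver.Ring as RingSolver
open import Algebra.Solver.Ring.AlmostCommutativeRing using (_-Raw-AlmostCommutative⟶_; fromCommutativeRing)
open import Algebra.Structures using (IsCommutativeRing)
open import Data.Bool.Base using (true; false)
open import Data.Empty using (⊥)
open import Data.Fin using (#_)
open import Data.Fin.Patterns
open import Data.Integer.Base as ℤ using (ℤ; +_; -[1+_])
import Data.Integer.Properties as ℤ
open import Data.List.Base
  using (List; []; _∷_; _++_; _∷ʳ_; map; foldr; filter; length; upTo; downFrom; take)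
open import Data.List.Membership.Propositional using (_∈_; find; lose)
open import Data.List.Membership.Propositional.Properties
  using (∈-++⁺ˡ; ∈-++⁺ʳ; ∈-++⁻; ∈-map⁺; ∈-map⁻; ∈-filter⁺; ∈-filter⁻; ∈-downFrom⁻; ∈-∃++
        ; ∈-cartesianProductWith⁺; ∈-cartesianProductWith⁻)
open import Data.List.Membership.Propositional.Properties.WithK using (unique∧set⇒bag)
import Data.List.Properties as List
open import Data.List.Relation.Binary.BagAndSetEquality using (∼bag⇒↭)
open import Data.List.Relation.Binary.Permutation.Propositional
  using (_↭_; ↭-refl; ↭-sym; ↭-trans; ↭-reflexive; prep; ↭⇒↭ₛ; ↭⇒↭ₛ′)
open import Data.List.Relation.Binary.Permutation.Propositional.Properties
  using (↭-empty-inv; ∈-resp-↭; All-resp-↭; ↭-length; drop-mid; drop-∷; shift; ↭-reverse; map⁺)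
import Data.List.Relation.Binary.Permutation.Setoid.Properties as SetoidPermutation
open import Data.List.Relation.Unary.All as All using (All; []; _∷_)
import Data.List.Relation.Unary.All.Properties as All
open import Data.List.Relation.Unary.AllPairs as AllPairs using (AllPairs; []; _∷_)
import Data.List.Relation.Unary.AllPairs.Properties as AllPairs
open import Data.List.Relation.Unary.Any using (here; there)
open import Data.List.Relation.Unary.Unique.Propositional using (Unique)
import Data.List.Relation.Unary.Unique.Propositional.Properties as Unique
open import Data.Maybe.Base using (Maybe; just; nothing)
open import Data.Nat.Base as ℕ using (ℕ; zero; suc; z≤n; s≤s; _≤_; _<_; _>_; _∸_)
import Data.Nat.Properties as ℕ
open import Data.List.Relation.Unary.Unique.DecPropositional ℕ._≟_ using (unique?)
open import Data.Product.Base using (∃; ∃₂; _×_; _,_)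
import Data.Rational.Properties as ℚ
open import Data.Sum.Base using (inj₁; inj₂)
open import Data.Unit.Base using (⊤; tt)
open import Data.Vec.Base using (Vec; []; _∷_)
open import Function.Base using (_∘_; case_of_)
open import Function.Bundles using (mk⇔)
open import Level using (_⊔_)
open import Relation.Binary.PropositionalEquality as ≡ using (_≡_; _≢_)
import Relation.Binary.Reasoning.Setoid as SetoidReasoning
open import Relation.Nullary.Decidable.Core using (Dec; yes; no)
open import Relation.Nullary.Negation.Core using (¬_; contradiction)

open import Defs
  using (module Polynomial; module PowerSeries; module ℚ[y]; module ℚ[y,x₁]; module ℚ[y,x₁,x₂]; module ℚ[y,x₁,x₂,x₃]
        ; module Series; Word; words; permutations; red; subsequences; Avoids; avoids?; avoiders; des; mch)

-- Rings of power series and polynomials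

-- Substituting `u = A₀` kills the kernel and leaves a relation for the height-0 series `S₀` alone.
-- At `u = 1` the kernel is `- t * y * V`, which does not vanish, and the relation ties `S` at 1 to
-- `S₀`. Nothing is inverted on the way, so the outcome is that `V * q A₀ * (A * D - N)` vanishes,
-- and a factor has to be cancelled. No integral-domain argument is needed for this: modulo `t` the
-- factor is `x₃`, multiplication by `x₃` shifts coefficients, and the cancellation lifts to power
-- series. In the same way `D` is non-zero because it is `x₃ * (x₂ - x₁)` modulo `t`. The
-- eliminations are ideal memberships between polynomials in eleven variables, valid in every
-- commutative ring and checked by normalising closed syntax. Ring structures are attached to raw
-- rings, so that their operations are definitionally those in which `A`, `N` and `D` are written.

IsCommRing : ∀ {c ℓ} → RawRing c ℓ → Set (c ⊔ ℓ)
IsCommRing R = IsCommutativeRing _≈′_ _+′_ _*′_ (-′_) 0#′ 1#′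
  where open RawRing R renaming
          (_≈_ to _≈′_; _+_ to _+′_; _*_ to _*′_; -_ to -′_; 0# to 0#′; 1# to 1#′)

toCommutativeRing : ∀ {c ℓ} {R : RawRing c ℓ} → IsCommRing R → CommutativeRing c ℓ
toCommutativeRing isCommRing = record { isCommutativeRing = isCommRing }

module PowerSeriesRing {c ℓ} {R : RawRing c ℓ} (isCommRing : IsCommRing R) where
  open CommutativeRing (toCommutativeRing isCommRing) hiding (rawRing)
  open CommutativeSemigroupProperties +-commutativeSemigroup using (interchange)
  open SetoidReasoning setoid
  private
    module S = RawRing (PowerSeries.rawRing R)
    variable f g : S.Carrier

  -- The sum defining a product unfolds so that `(f * g) (suc n)` is definitionally
  -- `f 0 * g (suc n) + (tail f * g) n`. The ring laws below follow by induction along this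
  -- recursion, which consumes the left factor.
  tail : S.Carrier → S.Carrier
  tail f n = f (suc n)

  *₀ : ∀ f g → (f S.* g) 0 ≈ f 0 * g 0
  *₀ f g = +-identityʳ _

  const-0# : ∀ n → S.0# n ≈ 0#
  const-0# zero    = refl
  const-0# (suc n) = refl

  *-congˢ : ∀ {f f′ g g′} → f S.≈ f′ → g S.≈ g′ → f S.* g S.≈ f′ S.* g′
  *-congˢ                  p q zero    = +-congʳ (*-cong (p 0) (q 0))
  *-congˢ {f} {f′} {g} {g′} p q (suc n) =
    +-cong (*-cong (p 0) (q (suc n))) (*-congˢ {tail f} {tail f′} {g} {g′} (λ i → p (suc i)) q n)

  *-vanishˡ : ∀ f g → (∀ n → f n ≈ 0#) → ∀ n → (f S.* g) n ≈ 0#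
  *-vanishˡ f g p zero    = trans (*₀ f g) (trans (*-congʳ (p 0)) (zeroˡ _))
  *-vanishˡ f g p (suc n) = begin
    f 0 * g (suc n) + (tail f S.* g) n
      ≈⟨ +-cong (trans (*-congʳ (p 0)) (zeroˡ _)) (*-vanishˡ (tail f) g (λ i → p (suc i)) n) ⟩
    0# + 0#  ≈⟨ +-identityˡ _ ⟩
    0#       ∎

  const-* : ∀ a f n → (S._*_ (PowerSeries.const R a) f) n ≈ a * f n
  const-* a f zero    = +-identityʳ _
  const-* a f (suc n) = trans (+-congˡ (*-vanishˡ (λ _ → 0#) f (λ _ → refl) n)) (+-identityʳ _)

  X-*₀ : ∀ f → (PowerSeries.X R S.* f) 0 ≈ 0#
  X-*₀ f = trans (*₀ (PowerSeries.X R) f) (zeroˡ _)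

  X-*₊ : ∀ f n → (PowerSeries.X R S.* f) (suc n) ≈ f n
  X-*₊ f n = begin
    0# * f (suc n) + (tail (PowerSeries.X R) S.* f) n  ≈⟨ +-cong (zeroˡ _) (*-congˢ {g = f} tail-X (λ _ → refl) n) ⟩
    0# + (S.1# S.* f) n                                ≈⟨ +-identityˡ _ ⟩
    (S.1# S.* f) n                                     ≈⟨ const-* 1# f n ⟩
    1# * f n                                           ≈⟨ *-identityˡ _ ⟩
    f n                                                ∎
    where
    tail-X : tail (PowerSeries.X R) S.≈ S.1#
    tail-X zero    = refl
    tail-X (suc n) = refl

  scale-* : ∀ a f g n → ((λ i → a * f i) S.* g) n ≈ a * (f S.* g) n
  scale-* a f g zero    = trans (+-identityʳ _) (trans (*-assoc _ _ _) (*-congˡ (sym (+-identityʳ _))))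
  scale-* a f g (suc n) = begin
    a * f 0 * g (suc n) + ((λ i → a * f (suc i)) S.* g) n  ≈⟨ +-cong (*-assoc _ _ _) (scale-* a (tail f) g n) ⟩
    a * (f 0 * g (suc n)) + a * (tail f S.* g) n           ≈⟨ distribˡ _ _ _ ⟨
    a * (f S.* g) (suc n)                                  ∎

  *-distribʳ : ∀ h f g → (f S.+ g) S.* h S.≈ f S.* h S.+ g S.* h
  *-distribʳ h f g zero = begin
    (f 0 + g 0) * h 0 + 0#               ≈⟨ +-identityʳ _ ⟩
    (f 0 + g 0) * h 0                    ≈⟨ distribʳ _ _ _ ⟩
    f 0 * h 0 + g 0 * h 0                ≈⟨ +-cong (*₀ f h) (*₀ g h) ⟨
    (f S.* h) 0 + (g S.* h) 0            ∎
  *-distribʳ h f g (suc n) = begin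
    (f 0 + g 0) * h (suc n) + ((tail f S.+ tail g) S.* h) n
      ≈⟨ +-cong (distribʳ _ _ _) (*-distribʳ h (tail f) (tail g) n) ⟩
    (f 0 * h (suc n) + g 0 * h (suc n)) + ((tail f S.* h) n + (tail g S.* h) n)
      ≈⟨ interchange _ _ _ _ ⟩
    (f S.* h) (suc n) + (g S.* h) (suc n) ∎

  -- The mirror image of the defining recursion, consuming the right factor; commutativity compares
  -- the two.
  *-sucʳ : ∀ f g n → (f S.* g) (suc n) ≈ (f S.* tail g) n + f (suc n) * g 0
  *-sucʳ f g zero    = +-cong (sym (*₀ f (tail g))) (+-identityʳ _)
  *-sucʳ f g (suc n) = trans (+-congˡ (*-sucʳ (tail f) g n)) (sym (+-assoc _ _ _))

  *-commˢ : ∀ f g → f S.* g S.≈ g S.* f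
  *-commˢ f g zero    = +-congʳ (*-comm _ _)
  *-commˢ f g (suc n) = begin
    f 0 * g (suc n) + (tail f S.* g) n  ≈⟨ +-cong (*-comm _ _) (*-commˢ (tail f) g n) ⟩
    g (suc n) * f 0 + (g S.* tail f) n  ≈⟨ +-comm _ _ ⟩
    (g S.* tail f) n + g (suc n) * f 0  ≈⟨ *-sucʳ g f n ⟨
    (g S.* f) (suc n)                   ∎

  *-assocˢ : ∀ f g h → (f S.* g) S.* h S.≈ f S.* (g S.* h)
  *-assocˢ f g h zero = begin
    (f 0 * g 0 + 0#) * h 0 + 0#  ≈⟨ +-congʳ (*-congʳ (+-identityʳ _)) ⟩
    f 0 * g 0 * h 0 + 0#         ≈⟨ +-congʳ (*-assoc _ _ _) ⟩
    f 0 * (g 0 * h 0) + 0#       ≈⟨ +-congʳ (*-congˡ (+-identityʳ _)) ⟨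
    f 0 * (g 0 * h 0 + 0#) + 0#  ∎
  *-assocˢ f g h (suc n) = begin
    (f 0 * g 0 + 0#) * h (suc n) + (((λ i → f 0 * tail g i) S.+ tail f S.* g) S.* h) n
      ≈⟨ +-cong (trans (*-congʳ (+-identityʳ _)) (*-assoc _ _ _))
                (trans (*-distribʳ h (λ i → f 0 * tail g i) (tail f S.* g) n) (+-cong (scale-* (f 0) (tail g) h n) (*-assocˢ (tail f) g h n))) ⟩
    f 0 * (g 0 * h (suc n)) + (f 0 * (tail g S.* h) n + (tail f S.* (g S.* h)) n)
      ≈⟨ +-assoc _ _ _ ⟨
    f 0 * (g 0 * h (suc n)) + f 0 * (tail g S.* h) n + (tail f S.* (g S.* h)) n
      ≈⟨ +-congʳ (distribˡ _ _ _) ⟨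
    f 0 * (g S.* h) (suc n) + (tail f S.* (g S.* h)) n ∎

  *-identityˡˢ : ∀ f → S.1# S.* f S.≈ f
  *-identityˡˢ f n = trans (const-* 1# f n) (*-identityˡ _)

  isCommRingˢ : IsCommRing (PowerSeries.rawRing R)
  isCommRingˢ = record
    { isRing = record
      { +-isAbelianGroup = record
        { isGroup = record
          { isMonoid = record
            { isSemigroup = record
              { isMagma = record
                { isEquivalence = record
                  { refl  = λ _ → refl
                  ; sym   = λ p n → sym (p n)
                  ; trans = λ p q n → trans (p n) (q n)
                  }
                ; ∙-cong = λ p q n → +-cong (p n) (q n)
                }
              ; assoc = λ _ _ _ _ → +-assoc _ _ _
              }
            ; identity = (λ _ n → trans (+-congʳ (const-0# n)) (+-identityˡ _))
                       , (λ _ n → trans (+-congˡ (const-0# n)) (+-identityʳ _))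
            }
          ; inverse = (λ _ n → trans (-‿inverseˡ _) (sym (const-0# n)))
                    , (λ _ n → trans (-‿inverseʳ _) (sym (const-0# n)))
          ; ⁻¹-cong = λ p n → -‿cong (p n)
          }
        ; comm = λ _ _ _ → +-comm _ _
        }
      ; *-cong     = λ {f} {f′} {g} {g′} → *-congˢ {f} {f′} {g} {g′}
      ; *-assoc    = *-assocˢ
      ; *-identity = *-identityˡˢ
                   , (λ f n → trans (*-commˢ f S.1# n) (*-identityˡˢ f n))
      ; distrib    = (λ f g h n → trans (*-commˢ f (g S.+ h) n)
                                  (trans (*-distribʳ f g h n) (+-cong (*-commˢ g f n) (*-commˢ h f n))))
                   , *-distribʳ
      }
    ; *-comm = *-commˢ
    }

  NonZeroDivisor : Carrier → Set _
  NonZeroDivisor a = ∀ {b} → a * b ≈ 0# → b ≈ 0#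

  -- The lowest coefficient of the product is `f 0 * g 0`, so `g 0` vanishes; then `f * tail g`
  -- vanishes too, and the argument repeats.
  *-cancelˢ : NonZeroDivisor (f 0) → f S.* g S.≈ S.0# → g S.≈ S.0#
  *-cancelˢ {f} {g} nzd fg≈0 n = trans (go {g} n (λ i → trans (fg≈0 i) (const-0# i))) (sym (const-0# n))
    where
    go : ∀ {g} n → (∀ i → (f S.* g) i ≈ 0#) → g n ≈ 0#
    go {g} zero    fg≈0 = nzd (trans (sym (*₀ f g)) (fg≈0 0))
    go {g} (suc n) fg≈0 = go {tail g} n λ i → begin
      (f S.* tail g) i                      ≈⟨ +-identityʳ _ ⟨
      (f S.* tail g) i + 0#                 ≈⟨ +-congˡ (zeroʳ _) ⟨
      (f S.* tail g) i + f (suc i) * 0#     ≈⟨ +-congˡ (*-congˡ (go {g} 0 fg≈0)) ⟨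
      (f S.* tail g) i + f (suc i) * g 0    ≈⟨ *-sucʳ f g i ⟨
      (f S.* g) (suc i)                     ≈⟨ fg≈0 (suc i) ⟩
      0#                                    ∎

module PolynomialRing {c ℓ} {R : RawRing c ℓ} (isCommRing : IsCommRing R) where
  open CommutativeRing (toCommutativeRing isCommRing) hiding (rawRing)
  open PowerSeriesRing isCommRing
  open RingProperties ring using (-0#≈0#)
  open Polynomial R using (coeff)
  private
    module P = RawRing (Polynomial.rawRing R)
    module S = RawRing (PowerSeries.rawRing R)

  coeff-+ : ∀ p q n → coeff (p P.+ q) n ≈ coeff p n + coeff q n
  coeff-+ []      q       n       = sym (+-identityˡ _)
  coeff-+ (a ∷ p) []      n       = sym (+-identityʳ _)
  coeff-+ (a ∷ p) (b ∷ q) zero    = refl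
  coeff-+ (a ∷ p) (b ∷ q) (suc n) = coeff-+ p q n

  coeff-scale : ∀ a p n → coeff (map (a *_) p) n ≈ a * coeff p n
  coeff-scale a []      n       = sym (zeroʳ a)
  coeff-scale a (b ∷ p) zero    = refl
  coeff-scale a (b ∷ p) (suc n) = coeff-scale a p n

  coeff-* : ∀ p q n → coeff (p P.* q) n ≈ (coeff p S.* coeff q) n
  coeff-* []      q n       = sym (*-vanishˡ (coeff []) (coeff q) (λ _ → refl) n)
  coeff-* (a ∷ p) q zero    =
    trans (coeff-+ (map (a *_) q) (0# ∷ p P.* q) 0) (+-congʳ (coeff-scale a q 0))
  coeff-* (a ∷ p) q (suc n) =
    trans (coeff-+ (map (a *_) q) (0# ∷ p P.* q) (suc n)) (+-cong (coeff-scale a q (suc n)) (coeff-* p q n))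

  coeff-neg : ∀ p n → coeff (P.- p) n ≈ - coeff p n
  coeff-neg []      n       = sym -0#≈0#
  coeff-neg (a ∷ p) zero    = refl
  coeff-neg (a ∷ p) (suc n) = coeff-neg p n

  coeff-1# : ∀ n → coeff P.1# n ≈ S.1# n
  coeff-1# zero    = refl
  coeff-1# (suc n) = refl

  -- Polynomials are compared by their coefficients, so injectivity is the identity, and the ring
  -- laws are pulled back from power series over the same ring.
  coeff-isRingMonomorphism :
    IsRingMonomorphism (Polynomial.rawRing R) (PowerSeries.rawRing R) coeff
  coeff-isRingMonomorphism = record
    { isRingHomomorphism = record
      { isSemiringHomomorphism = record
        { isNearSemiringHomomorphism = record
          { +-isMonoidHomomorphism = record
            { isMagmaHomomorphism = record
              { isRelHomomorphism = record { cong = λ p → p }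
              ; homo = coeff-+
              }
            ; ε-homo = λ n → sym (const-0# n)
            }
          ; *-homo = coeff-*
          }
        ; 1#-homo = coeff-1#
        }
      ; -‿homo = coeff-neg
      }
    ; injective = λ p → p
    }

  isCommRingᵖ : IsCommRing (Polynomial.rawRing R)
  isCommRingᵖ = RingMonomorphism.isCommutativeRing coeff-isRingMonomorphism isCommRingˢ

  -- Multiplication by the variable only shifts coefficients. This serves for `x₃`, the outermost
  -- variable of the coefficient ring.
  X-nonZeroDivisor : PowerSeriesRing.NonZeroDivisor isCommRingᵖ (Polynomial.X R)
  X-nonZeroDivisor {p} Xp≈0 n = begin
    coeff p n                                          ≈⟨ X-*₊ (coeff p) n ⟨
    (PowerSeries.X R S.* coeff p) (suc n)              ≈⟨ *-congˢ {g = coeff p} coeff-X (λ _ → refl) (suc n) ⟨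
    (coeff (Polynomial.X R) S.* coeff p) (suc n)       ≈⟨ coeff-* (Polynomial.X R) p (suc n) ⟨
    coeff (Polynomial.X R P.* p) (suc n)               ≈⟨ Xp≈0 (suc n) ⟩
    0#                                                 ∎
    where
    open SetoidReasoning setoid
    coeff-X : coeff (Polynomial.X R) S.≈ PowerSeries.X R
    coeff-X zero          = refl
    coeff-X (suc zero)    = refl
    coeff-X (suc (suc n)) = refl

ℚ[y]-isCommRing : IsCommRing ℚ[y].rawRing
ℚ[y]-isCommRing = PolynomialRing.isCommRingᵖ (CommutativeRing.isCommutativeRing ℚ.+-*-commutativeRing)

ℚ[y,x₁]-isCommRing : IsCommRing ℚ[y,x₁].rawRing
ℚ[y,x₁]-isCommRing = PolynomialRing.isCommRingᵖ ℚ[y]-isCommRing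

ℚ[y,x₁,x₂]-isCommRing : IsCommRing ℚ[y,x₁,x₂].rawRing
ℚ[y,x₁,x₂]-isCommRing = PolynomialRing.isCommRingᵖ ℚ[y,x₁]-isCommRing

ℚ[y,x₁,x₂,x₃]-isCommRing : IsCommRing ℚ[y,x₁,x₂,x₃].rawRing
ℚ[y,x₁,x₂,x₃]-isCommRing = PolynomialRing.isCommRingᵖ ℚ[y,x₁,x₂]-isCommRing

series-isCommRing : IsCommRing Series.rawRing
series-isCommRing = PowerSeriesRing.isCommRingˢ ℚ[y,x₁,x₂,x₃]-isCommRing

-- Polynomial identities with integer coefficients in an arbitrary commutative ring

module IntegerSolver {c ℓ} {R : RawRing c ℓ} (isCommRing : IsCommRing R) where
  private
    commutativeRing : CommutativeRing c ℓ
    commutativeRing = toCommutativeRing isCommRing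

  open CommutativeRing commutativeRing hiding (rawRing)
  open MonoidMult +-monoid using (1+×; ×-homo-+) renaming (_×_ to _×′_)
  open SemiringMult semiring using (×1-homo-*)
  open RingProperties ring
  open AbelianGroupProperties +-abelianGroup using (⁻¹-∙-comm; ⁻¹-involutive)
  open CommutativeSemigroupProperties +-commutativeSemigroup using (interchange; x∙yz≈y∙xz)
  open SetoidReasoning setoid

  -- With these multiples `1 ×′ 1#` reduces to `1#`, so `con (+ 1)` evaluates to `1#`
  -- definitionally. Matching the syntax with `N` and `D` by `≡.refl`, and reading `u = 1` both as a
  -- constant and as a value of `A₀`, depend on it.
  fromℤ : ℤ → Carrier
  fromℤ (+ n)    = n ×′ 1#
  fromℤ -[1+ n ] = - (suc n ×′ 1#)

  fromℤ-⊖ : ∀ m n → fromℤ (m ℤ.⊖ n) ≈ m ×′ 1# + - (n ×′ 1#)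
  fromℤ-⊖ m zero = sym (trans (+-congˡ -0#≈0#) (+-identityʳ _))
  fromℤ-⊖ zero (suc n) = sym (+-identityˡ _)
  fromℤ-⊖ (suc m) (suc n) = begin
    fromℤ (suc m ℤ.⊖ suc n)                    ≈⟨ reflexive (≡.cong fromℤ (ℤ.[1+m]⊖[1+n]≡m⊖n m n)) ⟩
    fromℤ (m ℤ.⊖ n)                            ≈⟨ fromℤ-⊖ m n ⟩
    m ×′ 1# + - (n ×′ 1#)                      ≈⟨ +-identityˡ _ ⟨
    0# + (m ×′ 1# + - (n ×′ 1#))               ≈⟨ +-congʳ (-‿inverseʳ 1#) ⟨
    (1# + - 1#) + (m ×′ 1# + - (n ×′ 1#))      ≈⟨ interchange _ _ _ _ ⟩
    (1# + m ×′ 1#) + (- 1# + - (n ×′ 1#))      ≈⟨ +-congˡ (⁻¹-∙-comm _ _) ⟩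
    (1# + m ×′ 1#) + - (1# + n ×′ 1#)          ≈⟨ +-cong (1+× m 1#) (-‿cong (1+× n 1#)) ⟨
    suc m ×′ 1# + - (suc n ×′ 1#)              ∎

  fromℤ-+ : ∀ i j → fromℤ (i ℤ.+ j) ≈ fromℤ i + fromℤ j
  fromℤ-+ (+ m)    (+ n)    = ×-homo-+ 1# m n
  fromℤ-+ (+ m)    -[1+ n ] = fromℤ-⊖ m (suc n)
  fromℤ-+ -[1+ m ] (+ n)    = trans (fromℤ-⊖ n (suc m)) (+-comm _ _)
  fromℤ-+ -[1+ m ] -[1+ n ] = begin
    - (suc (suc (m ℕ.+ n)) ×′ 1#)          ≈⟨ -‿cong (1+× (suc (m ℕ.+ n)) 1#) ⟩
    - (1# + (suc m ℕ.+ n) ×′ 1#)           ≈⟨ -‿cong (+-congˡ (×-homo-+ 1# (suc m) n)) ⟩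
    - (1# + (suc m ×′ 1# + n ×′ 1#))       ≈⟨ -‿cong (x∙yz≈y∙xz _ _ _) ⟩
    - (suc m ×′ 1# + (1# + n ×′ 1#))       ≈⟨ -‿cong (+-congˡ (1+× n 1#)) ⟨
    - (suc m ×′ 1# + suc n ×′ 1#)          ≈⟨ ⁻¹-∙-comm _ _ ⟨
    - (suc m ×′ 1#) + - (suc n ×′ 1#)      ∎

  fromℤ-neg : ∀ i → fromℤ (ℤ.- i) ≈ - fromℤ i
  fromℤ-neg (+ zero)  = sym -0#≈0#
  fromℤ-neg (+ suc n) = refl
  fromℤ-neg -[1+ n ]  = sym (⁻¹-involutive _)

  fromℤ-*₊ : ∀ m j → fromℤ (+ m ℤ.* j) ≈ m ×′ 1# * fromℤ j
  fromℤ-*₊ m (+ n) =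
    trans (reflexive (≡.cong fromℤ (≡.sym (ℤ.pos-* m n)))) (×1-homo-* m n)
  fromℤ-*₊ m -[1+ n ] = begin
    fromℤ (+ m ℤ.* -[1+ n ])           ≈⟨ reflexive (≡.cong fromℤ (≡.sym (ℤ.neg-distribʳ-* (+ m) (+ suc n)))) ⟩
    fromℤ (ℤ.- (+ m ℤ.* + suc n))      ≈⟨ fromℤ-neg (+ m ℤ.* + suc n) ⟩
    - fromℤ (+ m ℤ.* + suc n)          ≈⟨ -‿cong (fromℤ-*₊ m (+ suc n)) ⟩
    - (m ×′ 1# * (suc n ×′ 1#))        ≈⟨ -‿distribʳ-* _ _ ⟩
    m ×′ 1# * - (suc n ×′ 1#)          ∎

  fromℤ-* : ∀ i j → fromℤ (i ℤ.* j) ≈ fromℤ i * fromℤ j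
  fromℤ-* (+ m)    j = fromℤ-*₊ m j
  fromℤ-* -[1+ m ] j = begin
    fromℤ (-[1+ m ] ℤ.* j)             ≈⟨ reflexive (≡.cong fromℤ (≡.sym (ℤ.neg-distribˡ-* (+ suc m) j))) ⟩
    fromℤ (ℤ.- (+ suc m ℤ.* j))        ≈⟨ fromℤ-neg (+ suc m ℤ.* j) ⟩
    - fromℤ (+ suc m ℤ.* j)            ≈⟨ -‿cong (fromℤ-*₊ (suc m) j) ⟩
    - (suc m ×′ 1# * fromℤ j)          ≈⟨ -‿distribˡ-* _ _ ⟩
    - (suc m ×′ 1#) * fromℤ j          ∎

  fromℤ-morphism : ℤ.+-*-rawRing -Raw-AlmostCommutative⟶ fromCommutativeRing commutativeRing
  fromℤ-morphism = record
    { ⟦_⟧    = fromℤ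
    ; +-homo = fromℤ-+
    ; *-homo = fromℤ-*
    ; -‿homo = fromℤ-neg
    ; 0-homo = refl
    ; 1-homo = refl
    }

  fromℤ≟ : ∀ i j → Maybe (fromℤ i ≈ fromℤ j)
  fromℤ≟ i j with i ℤ.≟ j
  ... | yes i≡j = just (reflexive (≡.cong fromℤ i≡j))
  ... | no  _   = nothing

  open RingSolver ℤ.+-*-rawRing (fromCommutativeRing commutativeRing) fromℤ-morphism fromℤ≟ public
    using (Polynomial; con; var; _:+_; _:*_; _:-_; :-_; _:^_; _:×_; ⟦_⟧; ⟦_⟧N; normalise; correct)

  -- The hypothesis is about closed syntax, so that checking it never unfolds
  -- the ring operations.
  identity : ∀ {n} (p : Polynomial n) → normalise p ≡ normalise (con (+ 0)) → ∀ ρ → ⟦ p ⟧ ρ ≈ 0#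
  identity p p≡0 ρ = trans (sym (correct p ρ))
    (trans (reflexive (≡.cong (λ nf → ⟦ nf ⟧N ρ) p≡0)) (correct (con (+ 0)) ρ))

-- The polynomial identities behind the elimination

module Elimination {c ℓ} {R : RawRing c ℓ} (isCommRing : IsCommRing R) where
  open CommutativeRing (toCommutativeRing isCommRing) hiding (rawRing)
  open IntegerSolver isCommRing

  open AbelianGroupProperties +-abelianGroup using (x∙y⁻¹≈ε⇒x≈y; x≈y⇒x∙y⁻¹≈ε)

  private
    +-vanish : ∀ {a b} → a ≈ 0# → b ≈ 0# → a + b ≈ 0#
    +-vanish a≈0 b≈0 = trans (+-cong a≈0 b≈0) (+-identityˡ 0#)

    *-vanish : ∀ {a b} → b ≈ 0# → a * b ≈ 0#
    *-vanish b≈0 = trans (*-congˡ b≈0) (zeroʳ _)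

  S S₀ P Q W A₀ t y x₁ x₂ x₃ one : Polynomial 11
  S  = var 0F
  S₀ = var 1F
  P  = var 2F
  Q  = var 3F
  W  = var 4F
  A₀ = var 5F
  t  = var 6F
  y  = var 7F
  x₁ = var 8F
  x₂ = var 9F
  x₃ = var (# 10)
  one = con (+ 1)

  -- `q u` comes from runs of n: among the path equations only the one for `nn` contains its own
  -- unknown, and solving it would divide by `q u`. `S₀-rel u` is the part of the eliminated system
  -- without `S`.
  q kernel S₀-rel : Polynomial 11 → Polynomial 11
  q u = one :- t :* x₃ :* y :* u
  kernel u = q u :* (u :- one)
    :- u :* ((t :* x₃ :* y :+ t :^ 2 :* x₁ :* y :* u) :* q u :+ t :^ 3 :* x₂ :* x₃ :* y :^ 2 :* u :^ 2)
  S₀-rel u = q u :* S₀ :- u :* ((one :+ t :* u) :* q u :+ t :^ 2 :* u :^ 2 :* x₂ :* y)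

  -- At `u = 1` the summand with the factor `u - 1` drops out of the kernel, which leaves
  -- `- t * y * V`; `S₁-rel` is the resulting relation up to sign. `A-poly` is the series `A` in
  -- terms of `S` at 1 and `S₀`.
  V S₁-rel A-poly cofactor : Polynomial 11
  V = (x₃ :+ t :* x₁) :* q one :+ t :^ 2 :* x₂ :* x₃ :* y
  S₁-rel = t :* y :* V :* S :- (q one :* S₀ :- ((one :+ t) :* q one :+ t :^ 2 :* x₂ :* y))
  A-poly = one :+ t :* S₀ :+ t :^ 2 :* y :* (one :- x₃) :* S
  -- Found by polynomial division by the kernel.
  cofactor =
    (x₃ :- x₁) :* t :* (x₃ :+ t :* (x₂ :+ x₁ :* x₃ :- 2 :× y :* x₃ :^ 2)
      :+ t :^ 2 :* (x₁ :* x₂ :- y :* x₂ :* x₃ :+ y :* x₂ :* x₃ :^ 2 :- 2 :× y :* x₁ :* x₃ :^ 2 :+ y :^ 2 :* x₃ :^ 3)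
      :+ t :^ 3 :* (x₁ :- x₂) :* x₃ :* y :* (y :* x₃ :^ 2 :- x₂))
    :+ A₀ :* x₃ :* t :^ 2 :*
      ( x₂ :- x₁ :- y :* x₃ :^ 2 :+ y :* x₁ :* x₃
      :+ t :* (x₁ :* x₂ :- x₁ :^ 2 :- 3 :× y :* x₂ :* x₃ :+ y :* x₂ :^ 2 :+ 2 :× y :* x₁ :* x₃
             :- y :* x₁ :* x₃ :^ 2 :+ y :* x₁ :^ 2 :* x₃ :+ 2 :× y :^ 2 :* x₃ :^ 3 :- 2 :× y :^ 2 :* x₁ :* x₃ :^ 2)
      :+ t :^ 2 :* y :*
             (x₂ :^ 2 :* x₃ :- 4 :× x₁ :* x₂ :* x₃ :+ x₁ :* x₂ :^ 2 :+ 2 :× x₁ :^ 2 :* x₃ :+ 2 :× y :* x₂ :* x₃ :^ 2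
             :- y :* x₂ :* x₃ :^ 3 :- y :* x₂ :^ 2 :* x₃ :- y :* x₁ :* x₃ :^ 2 :+ 2 :× y :* x₁ :* x₃ :^ 3
             :+ y :* x₁ :* x₂ :* x₃ :^ 2 :- 2 :× y :* x₁ :^ 2 :* x₃ :^ 2 :- y :^ 2 :* x₃ :^ 4 :+ y :^ 2 :* x₁ :* x₃ :^ 3)
      :+ t :^ 3 :* (x₁ :- x₂) :* x₃ :* y :^ 2 :*
             (2 :× x₂ :* x₃ :- x₂ :^ 2 :- x₁ :* x₃ :- y :* x₃ :^ 3 :+ y :* x₁ :* x₃ :^ 2))
    :- A₀ :^ 2 :* (x₁ :- x₂) :* (x₂ :- x₃) :* x₃ :* y :* t :^ 3 :*
      ( one :+ t :* (x₁ :- 2 :× y :* x₃) :+ t :^ 2 :* x₃ :* y :* (x₂ :- 2 :× x₁ :+ y :* x₃)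
      :+ t :^ 3 :* x₃ :^ 2 :* y :^ 2 :* (x₁ :- x₂))

  -- Transcribed with the bracketing of `D` and `N`, so that the values are definitionally equal to
  -- them.
  D-poly N-poly : Polynomial 11
  D-poly =
    x₃ :* (x₁ :- x₂)
    :* ( A₀ :* x₃ :^ 2 :* t :^ 2 :* y :^ 2 :* (A₀ :* t :^ 2 :* y :* (x₁ :- x₂) :- one)
      :- (A₀ :+ one) :* x₃ :* t :* y :* (A₀ :* t :^ 2 :* y :* (x₁ :- x₂) :- one)
      :+ A₀ :* x₁ :* t :^ 2 :* y :- one)
  N-poly =
    x₁
    :* ( x₃ :^ 2 :* t :* y
        :* ( A₀ :^ 2 :* t :^ 2
            :* (x₂ :* t :^ 2 :* y :^ 2 :+ y :* (3 :× x₂ :* t :+ 2 :× x₂ :+ t :+ one) :+ one)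
          :+ A₀ :* ((x₂ :+ one) :* t :^ 3 :* y :+ t :^ 2 :* (2 :× x₂ :* y :+ y :+ 2 :× one) :+ t :+ one)
          :+ t :+ one)
      :+ x₂ :* t :^ 2 :* (:- (A₀ :^ 2 :* t :* y) :+ A₀ :- one)
      :+ A₀ :^ 2 :* x₃ :^ 4 :* t :^ 5 :* y :^ 3
      :- A₀ :* x₃ :^ 3 :* t :^ 2 :* y :^ 2
        :* ( A₀ :* (x₂ :+ one) :* t :^ 3 :* y
          :+ t :^ 2 :* (A₀ :* (2 :× x₂ :* y :+ y :+ 2 :× one) :+ one) :+ t :+ one)
      :+ x₃
        :* ( A₀ :* x₂ :* t :^ 4 :* y :* (A₀ :- y)
          :- A₀ :* t :^ 3 :* y :* (A₀ :* x₂ :+ x₂ :+ one)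
          :- A₀ :* t :^ 2 :* (x₂ :* y :+ y :+ one) :- t :- one))
    :+ x₂
      :* ( :- (A₀ :^ 2 :* x₃ :^ 4 :* t :^ 5 :* y :^ 3)
        :- x₃ :^ 2 :* t :* y
          :* ( A₀ :^ 2 :* (2 :× t :- one) :* t :^ 2 :* y
            :+ A₀ :* (t :^ 3 :* y :+ t :^ 2 :* (y :+ 2 :× one) :+ t :+ one) :+ t :+ one)
        :+ x₃
          :* ( t :^ 2 :* (:- (A₀ :^ 2 :* y) :+ y :+ one)
            :+ A₀ :* (A₀ :+ one) :* t :^ 3 :* y :+ t :+ one)
        :+ A₀ :* x₃ :^ 3 :* t :^ 2 :* y :^ 2 :* (A₀ :* t :^ 3 :* y :+ (A₀ :+ one) :* t :^ 2 :+ t :+ one)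
        :+ (A₀ :- one) :* t)
    :+ x₃ :* t :* (x₃ :* t :* y :- one) :* (A₀ :^ 2 :* x₃ :* t :* y :* (x₃ :* t :* y :- one) :+ A₀ :- one)
    :+ A₀ :* x₁ :^ 2 :* t :^ 2 :* y
      :* ( :- (A₀ :* x₂ :* t :^ 2) :+ A₀ :* x₃ :^ 3 :* t :^ 2 :* y :^ 2
        :- (A₀ :+ one) :* x₃ :^ 2 :* t :* y :+ x₃)
    :+ A₀ :* x₂ :^ 2 :* x₃ :* t :^ 3 :* y
      :* ( A₀ :* x₃ :^ 2 :* t :* (t :+ one) :* y :^ 2
        :- x₃ :* y :* (A₀ :* t :^ 2 :* y :+ 2 :× A₀ :* t :+ A₀ :+ t :+ one)
        :+ (A₀ :+ one) :* t :* y :+ one)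

  -- S, P, Q, W are minimaᵉ u □m, pathsᵉ u □m, pathsᵉ u mn, pathsᵉ u nn below,
  -- at u = A₀; eliminating P, Q, W leaves S with the coefficient kernel u.
  minima-eq □m-eq mn-eq nn-eq : Polynomial 11
  minima-eq = A₀ :* S :+ S₀ :- (A₀ :* P :+ S)
  □m-eq     = P :- (x₃ :* y :* (t :* S) :+ (one :+ A₀ :* (one :* (t :* Q))))
  mn-eq     = Q :- (x₁ :* y :* (t :* S) :+ (one :+ A₀ :* (x₂ :* y :* (t :* W))))
  nn-eq     = W :- (x₃ :* y :* (t :* S) :+ (one :+ A₀ :* (x₃ :* y :* (t :* W))))

  kernel-relation : ∀ ρ → ⟦ minima-eq ⟧ ρ ≈ 0# → ⟦ □m-eq ⟧ ρ ≈ 0# → ⟦ mn-eq ⟧ ρ ≈ 0# → ⟦ nn-eq ⟧ ρ ≈ 0# →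
                    ⟦ S₀-rel A₀ :+ S :* kernel A₀ ⟧ ρ ≈ 0#
  kernel-relation ρ e₁ e₂ e₃ e₄ = trans
    (x∙y⁻¹≈ε⇒x≈y _ _ (identity
      ((S₀-rel A₀ :+ S :* kernel A₀) :-
        -- The multipliers of back substitution: `A₀` removes `P`, a further `A₀ * t` removes `Q`, a
        -- further `A₀ * t * x₂ * y` removes `W`. The common factor `q A₀` is missing from the last
        -- one because `W` has the coefficient `q A₀` in `nn-eq`.
        (q A₀ :* minima-eq :+ q A₀ :* A₀ :* □m-eq :+ q A₀ :* A₀ :^ 2 :* t :* mn-eq
          :+ A₀ :^ 3 :* t :^ 2 :* x₂ :* y :* nn-eq))
      ≡.refl ρ))
    (+-vanish (+-vanish (+-vanish (*-vanish e₁) (*-vanish e₂)) (*-vanish e₃)) (*-vanish e₄))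

  S₀-relation : ∀ ρ → ⟦ S₀-rel A₀ :+ S :* kernel A₀ ⟧ ρ ≈ 0# → ⟦ kernel A₀ ⟧ ρ ≈ 0# → ⟦ S₀-rel A₀ ⟧ ρ ≈ 0#
  S₀-relation ρ e k = trans
    (x∙y⁻¹≈ε⇒x≈y _ _ (identity
      (S₀-rel A₀ :- ((S₀-rel A₀ :+ S :* kernel A₀) :+ (:- S) :* kernel A₀)) ≡.refl ρ))
    (+-vanish e (*-vanish k))

  S₁-relation : ∀ ρ → ⟦ S₀-rel one :+ S :* kernel one ⟧ ρ ≈ 0# → ⟦ S₁-rel ⟧ ρ ≈ 0#
  S₁-relation ρ e = trans
    (x∙y⁻¹≈ε⇒x≈y _ _ (identity
      (S₁-rel :- (:- one) :* (S₀-rel one :+ S :* kernel one)) ≡.refl ρ))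
    (*-vanish e)

  -- Here the slot `Q` holds the fraction in the equation of `A₀`, not a series of paths.
  -- Multiplying that equation by `q A₀` clears the fraction.
  kernel-root : ∀ ρ → ⟦ Q :* q A₀ :- t :^ 3 :* x₂ :* x₃ :* y :^ 2 :* A₀ :^ 3 ⟧ ρ ≈ 0# →
                ⟦ A₀ :- (one :+ t :* x₃ :* y :* A₀ :+ t :^ 2 :* x₁ :* y :* A₀ :^ 2 :+ Q) ⟧ ρ ≈ 0# →
                ⟦ kernel A₀ ⟧ ρ ≈ 0#
  kernel-root ρ e f = trans
    (x∙y⁻¹≈ε⇒x≈y _ _ (identity
      (kernel A₀ :-
        ((Q :* q A₀ :- t :^ 3 :* x₂ :* x₃ :* y :^ 2 :* A₀ :^ 3)
         :+ q A₀ :* (A₀ :- (one :+ t :* x₃ :* y :* A₀ :+ t :^ 2 :* x₁ :* y :* A₀ :^ 2 :+ Q))))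
      ≡.refl ρ))
    (+-vanish e (*-vanish f))

  -- The multiple of `S₁-rel` removes `S` from `V * q A₀ * A-poly * D-poly`; the `S₀` then present,
  -- with coefficient `t * (V + (1 - x₃) * q one) * q A₀ *
  -- D-poly`, is removed by `S₀-rel`. The rest involves only `A₀` and the parameters and is
  -- divisible by the kernel.
  elimination : ∀ ρ → ⟦ kernel A₀ ⟧ ρ ≈ 0# → ⟦ S₀-rel A₀ ⟧ ρ ≈ 0# → ⟦ S₁-rel ⟧ ρ ≈ 0# →
                ⟦ V :* q A₀ :* (A-poly :* D-poly :- N-poly) ⟧ ρ ≈ 0#
  elimination ρ k e₀ e₁ = trans
    (x∙y⁻¹≈ε⇒x≈y _ _ (identity
      (V :* q A₀ :* (A-poly :* D-poly :- N-poly) :-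
        (cofactor :* kernel A₀ :+ t :* (V :+ (one :- x₃) :* q one) :* D-poly :* S₀-rel A₀
          :+ t :* (one :- x₃) :* q A₀ :* D-poly :* S₁-rel))
      ≡.refl ρ))
    (+-vanish (+-vanish (*-vanish k) (*-vanish e₀)) (*-vanish e₁))

  -- What remains after splitting off the terms free of `t`, namely `x₃` and `x₃ * (x₂ - x₁)`, and
  -- dividing by `t`.
  V*q-tail D-tail : Polynomial 11
  V*q-tail = x₁ :* q one :* q A₀ :+ t :* x₂ :* x₃ :* y :* q A₀ :- x₃ :* x₃ :* y :* q A₀ :- x₃ :* x₃ :* y :* A₀
  D-tail = x₃ :* (x₁ :- x₂) :*
    ( A₀ :* x₃ :^ 2 :* t :* y :^ 2 :* (A₀ :* t :^ 2 :* y :* (x₁ :- x₂) :- one)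
    :- (A₀ :+ one) :* x₃ :* y :* (A₀ :* t :^ 2 :* y :* (x₁ :- x₂) :- one)
    :+ A₀ :* x₁ :* t :* y)

  V*q≈ : ∀ ρ → ⟦ V :* q A₀ ⟧ ρ ≈ ⟦ x₃ :+ t :* V*q-tail ⟧ ρ
  V*q≈ ρ = x∙y⁻¹≈ε⇒x≈y _ _ (identity (V :* q A₀ :- (x₃ :+ t :* V*q-tail)) ≡.refl ρ)

  D≈ : ∀ ρ → ⟦ D-poly ⟧ ρ ≈ ⟦ x₃ :* (x₂ :- x₁) :+ t :* D-tail ⟧ ρ
  D≈ ρ = x∙y⁻¹≈ε⇒x≈y _ _ (identity (D-poly :- (x₃ :* (x₂ :- x₁) :+ t :* D-tail)) ≡.refl ρ)

  -- At `u = 1` the two occurrences of `S` cancel. Combinatorially, a new minimum chosen at height 0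
  -- may reach any height, so all heights are summed.
  minima-at-one : ∀ ρ → ⟦ one :* S :+ S₀ :- (one :* P :+ S) ⟧ ρ ≈ 0# → ⟦ S₀ ⟧ ρ ≈ ⟦ P ⟧ ρ
  minima-at-one ρ e = x∙y⁻¹≈ε⇒x≈y _ _ (trans
    (x∙y⁻¹≈ε⇒x≈y _ _ (identity (S₀ :- P :- (one :* S :+ S₀ :- (one :* P :+ S))) ≡.refl ρ)) e)

  -- Here `P` stands for the paths from `m₁` and `S₀` for those from `□m`, both at `u = 1`. Their
  -- equations differ only in the weight of a following minimum, `y` against `x₃ * y`, so
  -- subtracting them removes `Q`.
  A-relation : ∀ ρ → ⟦ P :- (y :* (t :* S) :+ (one :+ one :* (one :* (t :* Q)))) ⟧ ρ ≈ 0# →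
               ⟦ S₀ :- (x₃ :* y :* (t :* S) :+ (one :+ one :* (one :* (t :* Q)))) ⟧ ρ ≈ 0# →
               ⟦ one :* (t :* P) :+ one ⟧ ρ ≈ ⟦ A-poly ⟧ ρ
  A-relation ρ e f = x∙y⁻¹≈ε⇒x≈y _ _ (trans
    (x∙y⁻¹≈ε⇒x≈y _ _ (identity
      (one :* (t :* P) :+ one :- A-poly :-
        (t :* (P :- (y :* (t :* S) :+ (one :+ one :* (one :* (t :* Q)))))
         :+ (:- t) :* (S₀ :- (x₃ :* y :* (t :* S) :+ (one :+ one :* (one :* (t :* Q)))))))
      ≡.refl ρ))
    (+-vanish (*-vanish e) (*-vanish f)))

  module _ (tᵛ yᵛ x₁ᵛ x₂ᵛ x₃ᵛ : Carrier) where
    env : (S S₀ P Q W A₀ : Carrier) → Vec Carrier 11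
    env S S₀ P Q W A₀ = S ∷ S₀ ∷ P ∷ Q ∷ W ∷ A₀ ∷ tᵛ ∷ yᵛ ∷ x₁ᵛ ∷ x₂ᵛ ∷ x₃ᵛ ∷ []

    -- Greek letters are values of the variables. The two sides are passed
    -- through propositional equalities because comparing unfolded power series
    -- up to _≈_ is very slow.
    combination : ∀ a σ σ₀ π θ ω σ′ π′ θ′ ω′ α κ →
      let ρ = env σ σ₀ 0# κ 0# α in
      ∀ {lhs rhs rhs′ denominator numerator} →
      ⟦ Q :* q A₀ ⟧ ρ ≡ lhs →
      ⟦ t :^ 3 :* x₂ :* x₃ :* y :^ 2 :* A₀ :^ 3 ⟧ ρ ≡ rhs →
      ⟦ one :+ t :* x₃ :* y :* A₀ :+ t :^ 2 :* x₁ :* y :* A₀ :^ 2 :+ Q ⟧ ρ ≡ rhs′ →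
      ⟦ D-poly ⟧ ρ ≡ denominator →
      ⟦ N-poly ⟧ ρ ≡ numerator →
      a ≈ ⟦ A-poly ⟧ (env σ σ₀ π θ ω 1#) →
      ⟦ S₀-rel A₀ :+ S :* kernel A₀ ⟧ (env σ σ₀ π θ ω 1#) ≈ 0# →
      ⟦ S₀-rel A₀ :+ S :* kernel A₀ ⟧ (env σ′ σ₀ π′ θ′ ω′ α) ≈ 0# →
      (∀ f → ⟦ V :* q A₀ ⟧ ρ * f ≈ 0# → f ≈ 0#) →
      lhs ≈ rhs →
      α ≈ rhs′ →
      a * denominator ≈ numerator
    combination a σ σ₀ π θ ω σ′ π′ θ′ ω′ α κ ≡.refl ≡.refl ≡.refl ≡.refl ≡.refl a≈ at-1 at-α cancel Q-eq A₀-eq =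
      trans (*-congʳ a≈)
      -- `S` is taken at `u = 1` while `A₀` has the value `α`. The environments may be mixed because
      -- `S₀-rel A₀` does not contain `S`, and `S₁-rel` does not contain `A₀`.
      (x∙y⁻¹≈ε⇒x≈y _ _ (cancel _ (elimination (env σ σ₀ 0# κ 0# α) kernel≈0
        (S₀-relation (env σ′ σ₀ π′ θ′ ω′ α) at-α kernel≈0)
        (S₁-relation (env σ σ₀ π θ ω 1#) at-1))))
      where
      kernel≈0 : ⟦ kernel A₀ ⟧ (env σ σ₀ 0# κ 0# α) ≈ 0#
      kernel≈0 = kernel-root (env σ σ₀ 0# κ 0# α) (x≈y⇒x∙y⁻¹≈ε Q-eq) (x≈y⇒x∙y⁻¹≈ε A₀-eq)

-- Substitution for the height

module Evaluation {c ℓ} {R : RawRing c ℓ} (isCommRing : IsCommRing R) where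
  private
    module R = CommutativeRing (toCommutativeRing isCommRing)
  open PowerSeriesRing isCommRing
  open CommutativeRing (toCommutativeRing isCommRingˢ) hiding (rawRing)
  open CommutativeSemigroupProperties +-commutativeSemigroup using (interchange)
  open CommutativeSemigroupProperties *-commutativeSemigroup using (x∙yz≈y∙xz)
  open SetoidReasoning setoid

  *-cong-≤ : ∀ u {f g} n → (∀ i → i ≤ n → f i R.≈ g i) → (u * f) n R.≈ (u * g) n
  *-cong-≤ u         zero    p = R.+-congʳ (R.*-congˡ (p 0 z≤n))
  *-cong-≤ u {f} {g} (suc n) p =
    R.+-cong (R.*-congˡ (p (suc n) ℕ.≤-refl)) (*-cong-≤ (tail u) {f} {g} n λ i i≤n → p i (ℕ.m≤n⇒m≤1+n i≤n))

  partialSum : Carrier → ℕ → (ℕ → Carrier) → Carrier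
  partialSum u zero    f = 0#
  partialSum u (suc B) f = f 0 + u * partialSum u B (f ∘ suc)

  -- Σ_b f b * u ^ b, meaningful when the order of f b tends to infinity.
  eval : Carrier → (ℕ → Carrier) → Carrier
  eval u f n = partialSum u (suc n) f n

  VanishesFrom : ℕ → ℕ → (ℕ → Carrier) → Set _
  VanishesFrom B n f = ∀ b → B ≤ b → ∀ i → i ≤ n → f b i R.≈ R.0#

  partialSum-suc : ∀ u B n f → (∀ i → i ≤ n → f B i R.≈ R.0#) →
                   partialSum u (suc B) f n R.≈ partialSum u B f n
  partialSum-suc u zero n f p =
    R.trans (R.+-cong (p n ℕ.≤-refl) (zeroʳ u n)) (R.+-identityˡ _)
  partialSum-suc u (suc B) n f p =
    R.+-congˡ (*-cong-≤ u {partialSum u (suc B) (f ∘ suc)} {partialSum u B (f ∘ suc)} n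
      λ m m≤n → partialSum-suc u B m (f ∘ suc) λ i i≤m → p i (ℕ.≤-trans i≤m m≤n))

  partialSum-stable : ∀ u B k n f → VanishesFrom B n f → partialSum u (k ℕ.+ B) f n R.≈ partialSum u B f n
  partialSum-stable u B zero    n f v = R.refl
  partialSum-stable u B (suc k) n f v =
    R.trans (partialSum-suc u (k ℕ.+ B) n f (v (k ℕ.+ B) (ℕ.m≤n+m B k))) (partialSum-stable u B k n f v)

  partialSum-≤ : ∀ u B C n f → VanishesFrom B n f → B ≤ C → partialSum u C f n R.≈ partialSum u B f n
  partialSum-≤ u B C n f v B≤C =
    ≡.subst (λ D → partialSum u D f n R.≈ partialSum u B f n) (ℕ.m∸n+n≡m B≤C)
            (partialSum-stable u B (C ∸ B) n f v)

  HasOrder : (ℕ → Carrier) → Set _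
  HasOrder f = ∀ b i → i < b → f b i R.≈ R.0#

  -- One order more than `HasOrder`. Splitting off the first term leaves `n` terms, not `suc n`, for
  -- the coefficient `n`; the missing term must vanish there.
  HasOrder⁺ : (ℕ → Carrier) → Set _
  HasOrder⁺ f = ∀ b i → i ≤ b → f b i R.≈ R.0#

  eval-cong : ∀ u {f g} → (∀ b → f b ≈ g b) → eval u f ≈ eval u g
  eval-cong u {f} {g} p n = partialSum-cong (suc n) {f} {g} p n
    where
    partialSum-cong : ∀ B {f g} → (∀ b → f b ≈ g b) → partialSum u B f ≈ partialSum u B g
    partialSum-cong zero            p = refl {0#}
    partialSum-cong (suc B) {f} {g} p =
      +-cong {f 0} {g 0} (p 0)
        (*-congˡ {u} {partialSum u B (f ∘ suc)} {partialSum u B (g ∘ suc)} (partialSum-cong B (p ∘ suc)))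

  eval-+ : ∀ u f g → eval u (λ b → f b + g b) ≈ eval u f + eval u g
  eval-+ u f g n = partialSum-+ (suc n) f g n
    where
    partialSum-+ : ∀ B f g → partialSum u B (λ b → f b + g b) ≈ partialSum u B f + partialSum u B g
    partialSum-+ zero    f g = sym {0# + 0#} {0#} (+-identityˡ 0#)
    partialSum-+ (suc B) f g = begin
      f 0 + g 0 + u * partialSum u B (λ b → f (suc b) + g (suc b))
        ≈⟨ +-congˡ {f 0 + g 0} (*-congˡ {u} (partialSum-+ B (f ∘ suc) (g ∘ suc))) ⟩
      f 0 + g 0 + u * (partialSum u B (f ∘ suc) + partialSum u B (g ∘ suc))
        ≈⟨ +-congˡ {f 0 + g 0} (distribˡ u _ _) ⟩
      f 0 + g 0 + (u * partialSum u B (f ∘ suc) + u * partialSum u B (g ∘ suc))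
        ≈⟨ interchange (f 0) (g 0) _ _ ⟩
      partialSum u (suc B) f + partialSum u (suc B) g ∎

  -- The left side truncates once, after `suc n` terms, whereas each coefficient `m ≤ n` of
  -- `eval u f` is truncated after `suc m` terms. The order of `f` makes the extra terms vanish.
  eval-* : ∀ u a {f} → HasOrder f → eval u (λ b → a * f b) ≈ a * eval u f
  eval-* u a {f} order n = R.trans (partialSum-* (suc n) f n)
    (*-cong-≤ a {partialSum u (suc n) f} {eval u f} n λ m m≤n →
      partialSum-≤ u (suc m) (suc n) m f (λ b m<b i i≤m → order b i (ℕ.≤-<-trans i≤m m<b)) (s≤s m≤n))
    where
    partialSum-* : ∀ B f → partialSum u B (λ b → a * f b) ≈ a * partialSum u B f
    partialSum-* zero    f = sym {a * 0#} {0#} (zeroʳ a)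
    partialSum-* (suc B) f = begin
      a * f 0 + u * partialSum u B (λ b → a * f (suc b))  ≈⟨ +-congˡ {a * f 0} (*-congˡ {u} (partialSum-* B (f ∘ suc))) ⟩
      a * f 0 + u * (a * partialSum u B (f ∘ suc))        ≈⟨ +-congˡ {a * f 0} (x∙yz≈y∙xz u a _) ⟩
      a * f 0 + a * (u * partialSum u B (f ∘ suc))        ≈⟨ distribˡ a (f 0) _ ⟨
      a * partialSum u (suc B) f                          ∎

  eval-∷ : ∀ u f → HasOrder⁺ (f ∘ suc) → eval u f ≈ f 0 + u * eval u (f ∘ suc)
  eval-∷ u f order n = R.+-congˡ
    (*-cong-≤ u {partialSum u n (f ∘ suc)} {eval u (f ∘ suc)} n λ m m≤n →
      R.trans (partialSum-≤ u m n m (f ∘ suc) (vanishes m) m≤n)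
              (R.sym (partialSum-≤ u m (suc m) m (f ∘ suc) (vanishes m) (ℕ.n≤1+n m))))
    where
    vanishes : ∀ m → VanishesFrom m m (f ∘ suc)
    vanishes m b m≤b i i≤m = order b i (ℕ.≤-trans i≤m m≤b)

-- The generating functions of the completions

-- What is remembered of the last two letters of a prefix: m stands for a
-- left-to-right minimum, n for any other letter, □ for an arbitrary one; ∅ and
-- m₁ are the prefixes of length 0 and 1.
data Context : Set where
  ∅ m₁ □m mn nn : Context

after-min after-non : Context → Context
after-min ∅ = m₁
after-min _ = □m
after-non nn = nn
after-non mn = nn
after-non _  = mn

module Paths {c ℓ} {R : RawRing c ℓ} (isCommRing : IsCommRing R)
             (y x₁ x₂ x₃ : RawRing.Carrier R) where
  private
    module R = CommutativeRing (toCommutativeRing isCommRing)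
    commutativeRingˢ = toCommutativeRing (PowerSeriesRing.isCommRingˢ isCommRing)
  open PowerSeriesRing isCommRing
  open CommutativeRing commutativeRingˢ hiding (rawRing; zero)
  open Evaluation isCommRing
  open SetoidReasoning setoid
  open PowerSeries R using (const) renaming (X to t)

  -- Each letter pays for the descent and the triple that it completes, so the context determines
  -- the price. After `m₁` there is a descent but not yet a triple.
  min-weight non-weight : Context → R.Carrier
  min-weight ∅  = R.1#
  min-weight m₁ = y
  min-weight □m = x₃ R.* y
  min-weight mn = x₁ R.* y
  min-weight nn = x₃ R.* y
  non-weight mn = x₂ R.* y
  non-weight nn = x₃ R.* y
  non-weight _  = R.1#

  -- paths s k a b is the total weight of the ways to complete a prefix by k
  -- letters, when a unused letters lie below its minimum and b above it;
  -- minima s k a b collects those that start with a new minimum.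
  mutual
    paths : Context → ℕ → ℕ → ℕ → R.Carrier
    paths s zero    a zero    = R.1#
    paths s zero    a (suc b) = R.0#
    paths s (suc k) a zero    = min-weight s R.* minima (after-min s) k a zero
    paths s (suc k) a (suc b) =
      min-weight s R.* minima (after-min s) k a (suc b) R.+ non-weight s R.* paths (after-non s) k a b

    minima : Context → ℕ → ℕ → ℕ → R.Carrier
    minima s k zero    b = R.0#
    -- Either the largest letter below becomes the minimum, or it is skipped and from then on counts
    -- as above. Here `k` counts the letters after the minimum and `s` already includes it.
    minima s k (suc a) b = paths s k a b R.+ minima s k a (suc b)

  mutual
    paths-vanish : ∀ s {k} a {b} → k < b → paths s k a b R.≈ R.0#
    paths-vanish s {zero}  a {suc b} k<b = R.refl
    paths-vanish s {suc k} a {suc b} (s≤s k<b) =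
      R.trans (R.+-cong (R.trans (R.*-congˡ (minima-vanish (after-min s) a (ℕ.m≤n⇒m≤1+n k<b))) (R.zeroʳ _))
                        (R.trans (R.*-congˡ (paths-vanish (after-non s) a k<b)) (R.zeroʳ _)))
              (R.+-identityˡ _)

    minima-vanish : ∀ s {k} a {b} → k < b → minima s k a b R.≈ R.0#
    minima-vanish s zero    k<b = R.refl
    minima-vanish s (suc a) k<b =
      R.trans (R.+-cong (paths-vanish s a k<b) (minima-vanish s a (ℕ.m≤n⇒m≤1+n k<b))) (R.+-identityˡ _)

  -- If `k` letters remain and `b` lie above, then `k ∸ b` lie below; for `minimaˢ` the minimum
  -- itself is one letter more. For `k < b` the truncated difference is harmless, since the weight
  -- vanishes for every number of letters below.
  pathsˢ minimaˢ : Context → ℕ → Carrier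
  pathsˢ  s b k = paths s k (k ∸ b) b
  minimaˢ s b k = minima s k (suc k ∸ b) b

  minimaˢ-rec : ∀ s b → minimaˢ s b ≈ pathsˢ s b + minimaˢ s (suc b)
  minimaˢ-rec s b k with ℕ.≤-<-connex b k
  ... | inj₁ b≤k rewrite ℕ.+-∸-assoc 1 b≤k = R.refl
  ... | inj₂ k<b = R.trans (minima-vanish s (suc k ∸ b) k<b) (R.sym (R.trans
    (R.+-cong (paths-vanish s (k ∸ b) k<b) (minima-vanish s (k ∸ b) (ℕ.m≤n⇒m≤1+n k<b))) (R.+-identityˡ _)))

  cons : Carrier → (ℕ → Carrier) → ℕ → Carrier
  cons f g zero    = f
  cons f g (suc b) = g b

  scale-X₀ : ∀ a f → (const a * (t * f)) 0 R.≈ R.0#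
  scale-X₀ a f = R.trans (const-* a (t * f) 0) (R.trans (R.*-congˡ (X-*₀ f)) (R.zeroʳ _))

  scale-X₊ : ∀ a f k → (const a * (t * f)) (suc k) R.≈ a R.* f k
  scale-X₊ a f k = R.trans (const-* a (t * f) (suc k)) (R.*-congˡ (X-*₊ f k))

  -- The `1#` at height 0 is the empty completion. An n starts from a positive height and lowers it,
  -- hence the shift by one.
  non-step : Context → ℕ → Carrier
  non-step s = cons 1# (λ b → const (non-weight s) * (t * pathsˢ (after-non s) b))

  pathsˢ-rec : ∀ s b → pathsˢ s b ≈ const (min-weight s) * (t * minimaˢ (after-min s) b) + non-step s b
  pathsˢ-rec s zero    zero    = R.sym (R.trans
    (R.+-congʳ (scale-X₀ (min-weight s) (minimaˢ (after-min s) 0))) (R.+-identityˡ _))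
  pathsˢ-rec s (suc b) zero    = R.sym (R.trans
    (R.+-cong (scale-X₀ (min-weight s) (minimaˢ (after-min s) (suc b))) (scale-X₀ (non-weight s) (pathsˢ (after-non s) b)))
    (R.+-identityˡ _))
  pathsˢ-rec s zero    (suc k) = R.sym (R.trans
    (R.+-identityʳ _) (scale-X₊ (min-weight s) (minimaˢ (after-min s) 0) k))
  pathsˢ-rec s (suc b) (suc k) = R.sym (R.+-cong
    (scale-X₊ (min-weight s) (minimaˢ (after-min s) (suc b)) k) (scale-X₊ (non-weight s) (pathsˢ (after-non s) b) k))

  pathsˢ-order : ∀ s → HasOrder (pathsˢ s)
  pathsˢ-order s b k = paths-vanish s (k ∸ b)

  minimaˢ-order : ∀ s → HasOrder (minimaˢ s)
  minimaˢ-order s b k = minima-vanish s (suc k ∸ b)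

  scale-X-order : ∀ a {f} → HasOrder f → HasOrder⁺ (λ b → const a * (t * f b))
  scale-X-order a {f} order b zero    _       = scale-X₀ a (f b)
  scale-X-order a {f} order b (suc i) (s≤s p) =
    R.trans (scale-X₊ a (f b) i) (R.trans (R.*-congˡ (order b i (s≤s p))) (R.zeroʳ a))

  module _ (u : Carrier) where
    pathsᵉ minimaᵉ : Context → Carrier
    pathsᵉ  s = eval u (pathsˢ s)
    minimaᵉ s = eval u (minimaˢ s)

    -- Shifting the height in `minimaˢ-rec` would give the quotient of `minimaᵉ s - minimaˢ s 0` by
    -- `u`. The equation is multiplied by `u` to avoid the division; this is where the second
    -- unknown `minimaˢ s 0` enters.
    minimaᵉ-eq : ∀ s → u * minimaᵉ s + minimaˢ s 0 ≈ u * pathsᵉ s + minimaᵉ s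
    minimaᵉ-eq s = begin
      u * minimaᵉ s + minimaˢ s 0
        ≈⟨ +-congʳ {minimaˢ s 0} (*-congˡ {u} (eval-cong u (minimaˢ-rec s))) ⟩
      u * eval u (λ b → pathsˢ s b + minimaˢ s (suc b)) + minimaˢ s 0
        ≈⟨ +-congʳ {minimaˢ s 0} (*-congˡ {u} (eval-+ u (pathsˢ s) (minimaˢ s ∘ suc))) ⟩
      u * (pathsᵉ s + eval u (minimaˢ s ∘ suc)) + minimaˢ s 0
        ≈⟨ +-congʳ {minimaˢ s 0} (distribˡ u (pathsᵉ s) (eval u (minimaˢ s ∘ suc))) ⟩
      u * pathsᵉ s + u * eval u (minimaˢ s ∘ suc) + minimaˢ s 0
        ≈⟨ +-assoc (u * pathsᵉ s) _ _ ⟩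
      u * pathsᵉ s + (u * eval u (minimaˢ s ∘ suc) + minimaˢ s 0)
        ≈⟨ +-congˡ {u * pathsᵉ s} (+-comm _ (minimaˢ s 0)) ⟩
      u * pathsᵉ s + (minimaˢ s 0 + u * eval u (minimaˢ s ∘ suc))
        ≈⟨ +-congˡ {u * pathsᵉ s} (eval-∷ u (minimaˢ s) (λ b i i≤b → minimaˢ-order s (suc b) i (s≤s i≤b))) ⟨
      u * pathsᵉ s + minimaᵉ s ∎

    eval-scale-X : ∀ a {f} → HasOrder f → eval u (λ b → const a * (t * f b)) ≈ const a * (t * eval u f)
    eval-scale-X a {f} order = begin
      eval u (λ b → const a * (t * f b))  ≈⟨ eval-cong u (λ b → sym (*-assoc (const a) t (f b))) ⟩
      eval u (λ b → const a * t * f b)    ≈⟨ eval-* u (const a * t) order ⟩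
      const a * t * eval u f              ≈⟨ *-assoc (const a) t (eval u f) ⟩
      const a * (t * eval u f)            ∎

    pathsᵉ-eq : ∀ s → pathsᵉ s ≈ const (min-weight s) * (t * minimaᵉ (after-min s))
                              + (1# + u * (const (non-weight s) * (t * pathsᵉ (after-non s))))
    pathsᵉ-eq s = begin
      pathsᵉ s
        ≈⟨ eval-cong u (pathsˢ-rec s) ⟩
      eval u (λ b → const (min-weight s) * (t * minimaˢ (after-min s) b) + non-step s b)
        ≈⟨ eval-+ u (λ b → const (min-weight s) * (t * minimaˢ (after-min s) b)) (non-step s) ⟩
      eval u (λ b → const (min-weight s) * (t * minimaˢ (after-min s) b)) + eval u (non-step s)
        ≈⟨ +-cong (eval-scale-X (min-weight s) (minimaˢ-order (after-min s)))
                  (eval-∷ u (non-step s) (scale-X-order (non-weight s) (pathsˢ-order (after-non s)))) ⟩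
      const (min-weight s) * (t * minimaᵉ (after-min s))
        + (1# + u * eval u (λ b → const (non-weight s) * (t * pathsˢ (after-non s) b)))
        ≈⟨ +-congˡ {const (min-weight s) * (t * minimaᵉ (after-min s))} (+-congˡ {1#} (*-congˡ {u}
             (eval-scale-X (non-weight s) (pathsˢ-order (after-non s))))) ⟩
      const (min-weight s) * (t * minimaᵉ (after-min s))
        + (1# + u * (const (non-weight s) * (t * pathsᵉ (after-non s)))) ∎

-- Solving the system at the two values of the height variable

module Solution {c ℓ} {R : RawRing c ℓ} (isCommRing : IsCommRing R)
                (y x₁ x₂ x₃ : RawRing.Carrier R)
                (x₃-nonZeroDivisor : PowerSeriesRing.NonZeroDivisor isCommRing x₃) where
  open PowerSeriesRing isCommRing
  open Paths isCommRing y x₁ x₂ x₃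
  open PowerSeries R using (const) renaming (X to t)
  open IntegerSolver isCommRingˢ using (⟦_⟧; _:+_; _:*_; _:^_)
  private
    module R = CommutativeRing (toCommutativeRing isCommRing)
    module E = Elimination isCommRingˢ
  open CommutativeRing (toCommutativeRing isCommRingˢ) hiding (rawRing; zero)
  open AbelianGroupProperties +-abelianGroup using (x≈y⇒x∙y⁻¹≈ε)
  open SetoidReasoning setoid

  const-homo-* : ∀ a b → const (a R.* b) ≈ const a * const b
  const-homo-* a b zero    = R.sym (const-* a (const b) 0)
  const-homo-* a b (suc n) = R.sym (R.trans (const-* a (const b) (suc n)) (R.zeroʳ a))

  -- Products of constants instead of constants of products, as the equations with separate
  -- variables for `x₁`, `x₂`, `x₃` and `y` require.
  min-weightˢ non-weightˢ : Context → Carrier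
  min-weightˢ ∅  = 1#
  min-weightˢ m₁ = const y
  min-weightˢ □m = const x₃ * const y
  min-weightˢ mn = const x₁ * const y
  min-weightˢ nn = const x₃ * const y
  non-weightˢ mn = const x₂ * const y
  non-weightˢ nn = const x₃ * const y
  non-weightˢ _  = 1#

  min-weight≈ : ∀ s → const (min-weight s) ≈ min-weightˢ s
  min-weight≈ ∅  = refl {1#}
  min-weight≈ m₁ = refl {const y}
  min-weight≈ □m = const-homo-* x₃ y
  min-weight≈ mn = const-homo-* x₁ y
  min-weight≈ nn = const-homo-* x₃ y

  non-weight≈ : ∀ s → const (non-weight s) ≈ non-weightˢ s
  non-weight≈ ∅  = refl {1#}
  non-weight≈ m₁ = refl {1#}
  non-weight≈ □m = refl {1#}
  non-weight≈ mn = const-homo-* x₂ y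
  non-weight≈ nn = const-homo-* x₃ y

  pathsᵉ≈ : ∀ u s → pathsᵉ u s ≈ min-weightˢ s * (t * minimaᵉ u (after-min s))
                               + (1# + u * (non-weightˢ s * (t * pathsᵉ u (after-non s))))
  pathsᵉ≈ u s = trans (pathsᵉ-eq u s)
    (+-cong (*-congʳ {t * minimaᵉ u (after-min s)} (min-weight≈ s))
            (+-congˡ {1#} (*-congˡ {u} (*-congʳ {t * pathsᵉ u (after-non s)} (non-weight≈ s)))))

  env : (S S₀ P Q W A₀ : Carrier) → Vec Carrier 11
  env = E.env t (const y) (const x₁) (const x₂) (const x₃)

  env-at : Carrier → Vec Carrier 11
  env-at u = env (minimaᵉ u □m) (minimaˢ □m 0) (pathsᵉ u □m) (pathsᵉ u mn) (pathsᵉ u nn) u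

  kernel-relation : ∀ u → ⟦ E.S₀-rel E.A₀ :+ E.S :* E.kernel E.A₀ ⟧ (env-at u) ≈ 0#
  kernel-relation u = E.kernel-relation (env-at u)
    (x≈y⇒x∙y⁻¹≈ε (minimaᵉ-eq u □m)) (x≈y⇒x∙y⁻¹≈ε (pathsᵉ≈ u □m))
    (x≈y⇒x∙y⁻¹≈ε (pathsᵉ≈ u mn)) (x≈y⇒x∙y⁻¹≈ε (pathsᵉ≈ u nn))

  minimaˢ-0 : ∀ s → minimaˢ s 0 ≈ pathsᵉ 1# s
  minimaˢ-0 s = E.minima-at-one (env (minimaᵉ 1# s) (minimaˢ s 0) (pathsᵉ 1# s) 0# 0# 0#)
    (x≈y⇒x∙y⁻¹≈ε (minimaᵉ-eq 1# s))

  paths-total : pathsˢ ∅ 0 ≈ ⟦ E.A-poly ⟧ (env-at 1#)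
  paths-total = begin
    pathsˢ ∅ 0                      ≈⟨ pathsˢ-rec ∅ 0 ⟩
    1# * (t * minimaˢ m₁ 0) + 1#     ≈⟨ +-congʳ {1#} (*-congˡ {1#} (*-congˡ {t} (minimaˢ-0 m₁))) ⟩
    1# * (t * pathsᵉ 1# m₁) + 1#     ≈⟨ E.A-relation
      (env (minimaᵉ 1# □m) (minimaˢ □m 0) (pathsᵉ 1# m₁) (pathsᵉ 1# mn) 0# 0#)
      (x≈y⇒x∙y⁻¹≈ε (pathsᵉ≈ 1# m₁))
      (x≈y⇒x∙y⁻¹≈ε (trans (minimaˢ-0 □m) (pathsᵉ≈ 1# □m))) ⟩
    ⟦ E.A-poly ⟧ (env-at 1#)        ∎

  V*q-nonZeroDivisor : ∀ S S₀ P Q W A₀ f → ⟦ E.V :* E.q E.A₀ ⟧ (env S S₀ P Q W A₀) * f ≈ 0# → f ≈ 0#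
  V*q-nonZeroDivisor S S₀ P Q W A₀ f = *-cancelˢ {⟦ E.V :* E.q E.A₀ ⟧ ρ} {f} λ Vq*b≈0 →
    x₃-nonZeroDivisor (R.trans (R.*-congʳ (R.sym constant-term)) Vq*b≈0)
    where
    ρ = env S S₀ P Q W A₀
    constant-term : ⟦ E.V :* E.q E.A₀ ⟧ ρ 0 R.≈ x₃
    constant-term = R.trans (E.V*q≈ ρ 0)
      (R.trans (R.+-congˡ (X-*₀ (⟦ E.V*q-tail ⟧ ρ))) (R.+-identityʳ _))

  module _ (A₀ Q : Carrier) where
    ρ : Vec Carrier 11
    ρ = E.env t (const y) (const x₁) (const x₂) (const x₃) (minimaᵉ 1# □m) (minimaˢ □m 0) 0# Q 0# A₀

    denominator-constant-term : ∀ {denominator} → ⟦ E.D-poly ⟧ ρ ≡ denominator → denominator ≈ 0# →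
                                x₃ R.* (x₂ R.+ (R.- x₁)) R.≈ R.0#
    denominator-constant-term ≡.refl D≈0 =
      R.trans (R.sym (*₀ (const x₃) (const x₂ + (- const x₁))))
      (R.trans (R.sym (R.trans (E.D≈ ρ 0) (R.trans (R.+-congˡ (X-*₀ (⟦ E.D-tail ⟧ ρ))) (R.+-identityʳ _))))
               (D≈0 0))

    paths*denominator≈numerator : ∀ {lhs rhs rhs′ denominator numerator} →
      ⟦ E.Q :* E.q E.A₀ ⟧ ρ ≡ lhs →
      ⟦ E.t :^ 3 :* E.x₂ :* E.x₃ :* E.y :^ 2 :* E.A₀ :^ 3 ⟧ ρ ≡ rhs →
      ⟦ E.one :+ E.t :* E.x₃ :* E.y :* E.A₀ :+ E.t :^ 2 :* E.x₁ :* E.y :* E.A₀ :^ 2 :+ E.Q ⟧ ρ ≡ rhs′ →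
      ⟦ E.D-poly ⟧ ρ ≡ denominator →
      ⟦ E.N-poly ⟧ ρ ≡ numerator →
      lhs ≈ rhs → A₀ ≈ rhs′ → pathsˢ ∅ 0 * denominator ≈ numerator
    paths*denominator≈numerator lhs≡ rhs≡ rhs′≡ D≡ N≡ =
      E.combination t (const y) (const x₁) (const x₂) (const x₃)
        (pathsˢ ∅ 0) (minimaᵉ 1# □m) (minimaˢ □m 0) (pathsᵉ 1# □m) (pathsᵉ 1# mn) (pathsᵉ 1# nn)
        (minimaᵉ A₀ □m) (pathsᵉ A₀ □m) (pathsᵉ A₀ mn) (pathsᵉ A₀ nn) A₀ Q
        lhs≡ rhs≡ rhs′≡ D≡ N≡ paths-total (kernel-relation 1#) (kernel-relation A₀)
        (V*q-nonZeroDivisor (minimaᵉ 1# □m) (minimaˢ □m 0) 0# Q 0# A₀)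

-- Enumeration of the words avoiding 123

module Enumeration where
  open import Relation.Binary.PropositionalEquality
    using (refl; sym; trans; cong; cong₂; subst; subst₂; setoid)
  open import Data.Nat.Base using (_+_)
  open SetoidPermutation (setoid ℕ) using (Unique-resp-↭)

  -- gen k m B lists the completions by k letters of a prefix whose minimum is
  -- suc m, B being the decreasing list of the unused letters above it: a
  -- letter that is not a new minimum must be the largest unused one, since
  -- otherwise the largest one, coming later, would complete a 123.
  mutual
    gen : ℕ → ℕ → List ℕ → List Word
    gen zero    m []      = [] ∷ []
    gen zero    m (x ∷ B) = []
    gen (suc k) m []      = genMin k m []
    gen (suc k) m (x ∷ B) = genMin k m (x ∷ B) ++ map (x ∷_) (gen k m B)

    genMin : ℕ → ℕ → List ℕ → List Word
    genMin k zero    B = []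
    genMin k (suc a) B = map (suc a ∷_) (gen k a B) ++ genMin k a (B ∷ʳ suc a)

  below : ℕ → List ℕ
  below m = map suc (downFrom m)

  ∈-below⁻ : ∀ {m x} → x ∈ below m → x ≤ m
  ∈-below⁻ x∈ with _ , i∈ , refl ← ∈-map⁻ suc x∈ = ∈-downFrom⁻ i∈

  -- The condition that a prefix with minimum `m` imposes on the rest: an ascent above `m` would
  -- complete a 123.
  NoAscentAbove : ℕ → Word → Set
  NoAscentAbove m = AllPairs (λ b c → m < b → ¬ b < c)

  data Avoids₁₂₃ : Word → Set where
    []  : Avoids₁₂₃ []
    _∷_ : ∀ {a w} → NoAscentAbove a w → Avoids₁₂₃ w → Avoids₁₂₃ (a ∷ w)

  Decreasing : List ℕ → Set
  Decreasing = AllPairs _>_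

  Decreasing-∷ʳ : ∀ {B a} → Decreasing B → All (a <_) B → Decreasing (B ∷ʳ a)
  Decreasing-∷ʳ dec a<B = AllPairs.++⁺ dec ([] ∷ []) (All.map (_∷ []) a<B)

  weaken-< : ∀ {m B} → All (suc m <_) B → All (m <_) B
  weaken-< = All.map (ℕ.<-trans (ℕ.n<1+n _))

  low-∷ʳ : ∀ {B a} → All (suc a <_) B → All (a <_) (B ∷ʳ suc a)
  low-∷ʳ a<B = All.++⁺ (weaken-< a<B) (ℕ.n<1+n _ ∷ [])

  ∷ʳ-below : ∀ B a → (B ∷ʳ suc a) ++ below a ≡ B ++ below (suc a)
  ∷ʳ-below B a = List.∷ʳ-++ B (suc a) (below a)

  length-∷ʳ : ∀ k m (B : List ℕ) x → suc k ≡ suc m + length B → suc k ≡ m + length (B ∷ʳ x)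
  length-∷ʳ k m B x eq = trans eq (trans (sym (ℕ.+-suc m (length B))) (cong (m ℕ.+_)
    (sym (trans (List.length-++ B) (ℕ.+-comm (length B) 1)))))

  NoAscentAbove-mono : ∀ {m n w} → m ≤ n → NoAscentAbove m w → NoAscentAbove n w
  NoAscentAbove-mono m≤n = AllPairs.map (λ h n<b → h (ℕ.≤-<-trans m≤n n<b))

  mutual
    gen-complete : ∀ k m B {w} → k ≡ m + length B → Decreasing B → All (suc m <_) B →
                   w ↭ B ++ below m → NoAscentAbove (suc m) w → Avoids₁₂₃ w → w ∈ gen k m B
    gen-complete zero zero [] k≡ dec low p na av with refl ← ↭-empty-inv p = here refl
    gen-complete (suc k) m B {[]} k≡ dec low p na av =
      contradiction (trans k≡ (trans (+-length B m) (sym (↭-length p)))) λ ()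
      where
      +-length : ∀ B m → m + length B ≡ length (B ++ below m)
      +-length B m = trans (ℕ.+-comm m (length B)) (trans
        (cong (length B ℕ.+_) (sym (trans (List.length-map suc (downFrom m)) (List.length-downFrom m))))
        (sym (List.length-++ B)))
    gen-complete (suc k) m [] {a ∷ w} k≡ dec low p na av =
      genMin-complete k m [] k≡ dec [] (∈-below⁻ (∈-resp-↭ p (here refl))) p av
    gen-complete (suc k) m (x ∷ B) {a ∷ w} k≡ dec@(x>B ∷ B-dec) low@(m<x ∷ low-B) p (na-a ∷ na) av@(_ ∷ av′)
      with ∈-++⁻ (x ∷ B) (∈-resp-↭ p (here refl))
    ... | inj₂ a∈below = ∈-++⁺ˡ (genMin-complete k m (x ∷ B) k≡ dec (weaken-< low) (∈-below⁻ a∈below) p av)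
    ... | inj₁ (here refl) = ∈-++⁺ʳ (genMin k m (x ∷ B)) (∈-map⁺ (x ∷_)
      (gen-complete k m B (ℕ.suc-injective (trans k≡ (ℕ.+-suc m (length B)))) B-dec low-B (drop-∷ p) na av′))
    ... | inj₁ (there a∈B) with ∈-resp-↭ (↭-sym p) (here refl)
    ...   | here refl = contradiction (All.lookup x>B a∈B) (ℕ.<-irrefl refl)
    ...   | there x∈w = contradiction (All.lookup x>B a∈B) (All.lookup na-a x∈w (All.lookup low-B a∈B))

    genMin-complete : ∀ k m B {a w} → suc k ≡ m + length B → Decreasing B → All (m <_) B →
                      a ≤ m → a ∷ w ↭ B ++ below m → Avoids₁₂₃ (a ∷ w) → a ∷ w ∈ genMin k m B
    genMin-complete k zero B {zero} k≡ dec low z≤n p av with ∈-++⁻ B (∈-resp-↭ p (here refl))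
    ... | inj₁ 0∈B = contradiction (All.lookup low 0∈B) λ ()
    genMin-complete k (suc m) B {a} k≡ dec low a≤ p av@(na ∷ av′) with a ℕ.≟ suc m
    ... | yes refl = ∈-++⁺ˡ (∈-map⁺ (suc m ∷_)
      (gen-complete k m B (ℕ.suc-injective k≡) dec low (drop-mid [] B p) na av′))
    ... | no a≢ = ∈-++⁺ʳ (map (suc m ∷_) (gen k m B)) (genMin-complete k m (B ∷ʳ suc m)
      (length-∷ʳ k m B (suc m) k≡) (Decreasing-∷ʳ dec low) (low-∷ʳ low) (ℕ.≤-pred (ℕ.≤∧≢⇒< a≤ a≢))
      (subst (_ ↭_) (sym (∷ʳ-below B m)) p) av)

  AllPairs-from-All : ∀ {a p r} {A : Set a} {P : A → Set p} {R : A → A → Set r} →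
                      (∀ {x y} → P x → R x y) → ∀ {xs} → All P xs → AllPairs R xs
  AllPairs-from-All P⇒R []         = []
  AllPairs-from-All P⇒R (px ∷ pxs) = All.universal (λ _ → P⇒R px) _ ∷ AllPairs-from-All P⇒R pxs

  mutual
    gen-sound : ∀ k m B {w} → k ≡ m + length B → Decreasing B → All (suc m <_) B → w ∈ gen k m B →
                w ↭ B ++ below m × NoAscentAbove (suc m) w × Avoids₁₂₃ w
    gen-sound zero zero [] k≡ dec low (here refl) = ↭-refl , [] , []
    gen-sound (suc k) m [] k≡ dec low w∈ = min-case k m [] k≡ dec [] w∈
    gen-sound (suc k) m (x ∷ B) k≡ dec@(x>B ∷ B-dec) low@(m<x ∷ low-B) w∈
      with ∈-++⁻ (genMin k m (x ∷ B)) w∈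
    ... | inj₁ w∈min = min-case k m (x ∷ B) k≡ dec (weaken-< low) w∈min
    ... | inj₂ w∈map with w′ , w′∈ , refl ← ∈-map⁻ (x ∷_) w∈map
        with p , na , av ← gen-sound k m B (ℕ.suc-injective (trans k≡ (ℕ.+-suc m (length B)))) B-dec low-B w′∈ =
      -- All remaining letters are below `x`, so `x` starts no ascent, and no later letter exceeds
      -- it.
      prep x p , All.map (λ c<x _ → ℕ.<-asym c<x) w′<x ∷ na
               , AllPairs-from-All (λ b<x x<b → contradiction x<b (ℕ.<-asym b<x)) w′<x ∷ av
      where
      w′<x : All (_< x) w′
      w′<x = All-resp-↭ (↭-sym p) (All.++⁺ x>B (All.tabulate λ c∈ →
        ℕ.≤-<-trans (∈-below⁻ c∈) (ℕ.<-trans (ℕ.n<1+n m) m<x)))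

    min-case : ∀ k m B {w} → suc k ≡ m + length B → Decreasing B → All (m <_) B → w ∈ genMin k m B →
               w ↭ B ++ below m × NoAscentAbove (suc m) w × Avoids₁₂₃ w
    min-case k m B k≡ dec low w∈ with genMin-sound k m B k≡ dec low w∈
    ... | a , w , refl , a≤m , p , na , av =
      p , All.universal (λ _ m<a _ → contradiction a≤m (ℕ.<⇒≱ (ℕ.<-trans (ℕ.n<1+n m) m<a))) w
          ∷ NoAscentAbove-mono (ℕ.m≤n⇒m≤1+n a≤m) na
        , na ∷ av

    genMin-sound : ∀ k m B {w} → suc k ≡ m + length B → Decreasing B → All (m <_) B → w ∈ genMin k m B →
                   ∃₂ λ a w′ → w ≡ a ∷ w′ × a ≤ m × w ↭ B ++ below m × NoAscentAbove a w′ × Avoids₁₂₃ w′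
    genMin-sound k (suc m) B k≡ dec low w∈ with ∈-++⁻ (map (suc m ∷_) (gen k m B)) w∈
    ... | inj₁ w∈map with w′ , w′∈ , refl ← ∈-map⁻ (suc m ∷_) w∈map
        with p , na , av ← gen-sound k m B (ℕ.suc-injective k≡) dec low w′∈ =
      suc m , w′ , refl , ℕ.≤-refl , ↭-trans (prep (suc m) p) (↭-sym (shift (suc m) B (below m))) , na , av
    ... | inj₂ w∈min with genMin-sound k m (B ∷ʳ suc m) (length-∷ʳ k m B (suc m) k≡) (Decreasing-∷ʳ dec low) (low-∷ʳ low) w∈min
    ...   | a , w′ , refl , a≤m , p , na , av =
      a , w′ , refl , ℕ.m≤n⇒m≤1+n a≤m , subst (_ ↭_) (∷ʳ-below B m) p , na , av

  genMin-head : ∀ k m B {w} → w ∈ genMin k m B → ∃₂ λ a w′ → w ≡ a ∷ w′ × a ≤ m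
  genMin-head k (suc m) B w∈ with ∈-++⁻ (map (suc m ∷_) (gen k m B)) w∈
  ... | inj₁ w∈map with w′ , _ , refl ← ∈-map⁻ (suc m ∷_) w∈map = suc m , w′ , refl , ℕ.≤-refl
  ... | inj₂ w∈min with a , w′ , refl , a≤m ← genMin-head k m (B ∷ʳ suc m) w∈min = a , w′ , refl , ℕ.m≤n⇒m≤1+n a≤m

  mutual
    -- First letters tell the concatenated lists apart: new minima are at most `m`, the letter `x`
    -- is larger; among the minima, `suc m` is followed by smaller choices only.
    gen-unique : ∀ k m B → All (m <_) B → Unique (gen k m B)
    gen-unique zero    m []      low = [] ∷ []
    gen-unique zero    m (x ∷ B) low = []
    gen-unique (suc k) m []      low = genMin-unique k m [] []
    gen-unique (suc k) m (x ∷ B) low@(m<x ∷ low-B) =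
      Unique.++⁺ (genMin-unique k m (x ∷ B) low) (Unique.map⁺ List.∷-injectiveʳ (gen-unique k m B low-B)) disjoint
      where
      disjoint : ∀ {w} → ¬ (w ∈ genMin k m (x ∷ B) × w ∈ map (x ∷_) (gen k m B))
      disjoint (w∈ , w∈map) with a , w′ , refl , a≤m ← genMin-head k m (x ∷ B) w∈
                            with _ , _ , refl ← ∈-map⁻ (x ∷_) w∈map = ℕ.<⇒≱ m<x a≤m

    genMin-unique : ∀ k m B → All (m <_) B → Unique (genMin k m B)
    genMin-unique k zero    B low = []
    genMin-unique k (suc m) B low =
      Unique.++⁺ (Unique.map⁺ List.∷-injectiveʳ (gen-unique k m B (weaken-< low)))
                 (genMin-unique k m (B ∷ʳ suc m) (low-∷ʳ low)) disjoint
      where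
      disjoint : ∀ {w} → ¬ (w ∈ map (suc m ∷_) (gen k m B) × w ∈ genMin k m (B ∷ʳ suc m))
      disjoint (w∈map , w∈) with a , w′ , refl , a≤m ← genMin-head k m (B ∷ʳ suc m) w∈
                            with _ , _ , refl ← ∈-map⁻ (suc m ∷_) w∈map = ℕ.<⇒≱ (ℕ.n<1+n m) a≤m

  -- Permutations as rearrangements of the letters

  letters↭below : ∀ n → map suc (upTo n) ↭ below n
  letters↭below n = map⁺ suc (↭-trans (↭-sym (↭-reverse (upTo n))) (↭-reflexive (List.reverse-upTo n)))

  ∈-words⁺ : ∀ {as} w → All (_∈ as) w → w ∈ words as (length w)
  ∈-words⁺ []      []         = here refl
  ∈-words⁺ (a ∷ w) (a∈ ∷ w∈)  = ∈-cartesianProductWith⁺ _∷_ a∈ (∈-words⁺ w w∈)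

  ∈-words⁻ : ∀ {as} k {w} → w ∈ words as k → All (_∈ as) w × length w ≡ k
  ∈-words⁻      zero    (here refl) = [] , refl
  ∈-words⁻ {as} (suc k) w∈
    with a , w , a∈ , w∈′ , refl ← ∈-cartesianProductWith⁻ _∷_ as (words as k) w∈
    with all , len ← ∈-words⁻ k w∈′ = a∈ ∷ all , cong suc len

  words-unique : ∀ {as} k → Unique as → Unique (words as k)
  words-unique zero    u = [] ∷ []
  words-unique (suc k) u = Unique.cartesianProductWith⁺ _∷_ List.∷-injective u (words-unique k u)

  -- Pigeonhole: each letter of `w` is deleted from `L` in turn, and equality of the lengths leaves
  -- nothing over.
  Unique∧⊆⇒↭ : ∀ (w L : List ℕ) → Unique w → All (_∈ L) w → length L ≡ length w → w ↭ L
  Unique∧⊆⇒↭ []      []      u        w⊆L        len = ↭-refl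
  Unique∧⊆⇒↭ (a ∷ w) L (a∉w ∷ u) (a∈L ∷ w⊆L) len with L₁ , L₂ , refl ← ∈-∃++ a∈L =
    ↭-trans (prep a (Unique∧⊆⇒↭ w (L₁ ++ L₂) u (All.zipWith drop-a (a∉w , w⊆L))
              (ℕ.suc-injective (trans (sym (List.length-++-sucʳ L₁ a L₂)) len))))
            (↭-sym (shift a L₁ L₂))
    where
    drop-a : ∀ {x} → a ≢ x × x ∈ L₁ ++ a ∷ L₂ → x ∈ L₁ ++ L₂
    drop-a (a≢x , x∈) with ∈-++⁻ L₁ x∈
    ... | inj₁ x∈L₁         = ∈-++⁺ˡ x∈L₁
    ... | inj₂ (here refl)  = contradiction refl a≢x
    ... | inj₂ (there x∈L₂) = ∈-++⁺ʳ L₁ x∈L₂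

  ∈-permutations⁻ : ∀ n {w} → w ∈ permutations n → w ↭ below n
  ∈-permutations⁻ n {w} w∈ with w∈words , u ← ∈-filter⁻ unique? w∈ with all , len ← ∈-words⁻ n w∈words =
    ↭-trans (Unique∧⊆⇒↭ w (map suc (upTo n)) u all
              (trans (List.length-map suc (upTo n)) (trans (List.length-upTo n) (sym len))))
            (letters↭below n)

  ∈-permutations⁺ : ∀ n {w} → w ↭ below n → w ∈ permutations n
  ∈-permutations⁺ n {w} p = ∈-filter⁺ unique?
    (subst (λ k → w ∈ words (map suc (upTo n)) k) len (∈-words⁺ w (All.tabulate λ x∈ →
      ∈-resp-↭ (↭-trans p (↭-sym (letters↭below n))) x∈)))
    (Unique-resp-↭ (↭⇒↭ₛ (↭-sym p)) (Unique.map⁺ ℕ.suc-injective (Unique.downFrom⁺ n)))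
    where
    len : length w ≡ n
    len = trans (↭-length p) (trans (List.length-map suc (downFrom n)) (List.length-downFrom n))

  permutations-unique : ∀ n → Unique (permutations n)
  permutations-unique n = Unique.filter⁺ unique? (words-unique n (Unique.map⁺ ℕ.suc-injective (Unique.upTo⁺ n)))

  -- Reductions of triples and occurrences of 123

  rank : ℕ → Word → ℕ
  rank a w = length (filter (ℕ._≤? a) w)

  -- A derivation lists the outcomes of the comparisons, so ranks of letters that are variables
  -- follow from inequalities alone.
  data Rank (a : ℕ) : Word → ℕ → Set where
    []   : Rank a [] 0
    _≤∷_ : ∀ {b w n} → b ≤ a → Rank a w n → Rank a (b ∷ w) (suc n)
    _>∷_ : ∀ {b w n} → a < b → Rank a w n → Rank a (b ∷ w) n

  infixr 5 _≤∷_ _>∷_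

  Rank⇒rank : ∀ {a w n} → Rank a w n → rank a w ≡ n
  Rank⇒rank         []         = refl
  Rank⇒rank {a = a} (b≤a ≤∷ r) = trans (cong length (List.filter-accept (ℕ._≤? a) b≤a)) (cong suc (Rank⇒rank r))
  Rank⇒rank {a = a} (a<b >∷ r) = trans (cong length (List.filter-reject (ℕ._≤? a) (ℕ.<⇒≱ a<b))) (Rank⇒rank r)

  red₃ : ∀ {a b c i j k} → Rank a (a ∷ b ∷ c ∷ []) i → Rank b (a ∷ b ∷ c ∷ []) j →
         Rank c (a ∷ b ∷ c ∷ []) k → red (a ∷ b ∷ c ∷ []) ≡ i ∷ j ∷ k ∷ []
  red₃ r s t = cong₂ _∷_ (Rank⇒rank r) (cong₂ _∷_ (Rank⇒rank s) (cong (_∷ []) (Rank⇒rank t)))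

  red-123⁺ : ∀ {a b c} → a < b → b < c → red (a ∷ b ∷ c ∷ []) ≡ 1 ∷ 2 ∷ 3 ∷ []
  red-123⁺ a<b b<c = red₃
    (ℕ.≤-refl ≤∷ a<b >∷ a<c >∷ [])
    (ℕ.<⇒≤ a<b ≤∷ ℕ.≤-refl ≤∷ b<c >∷ [])
    (ℕ.<⇒≤ a<c ≤∷ ℕ.<⇒≤ b<c ≤∷ ℕ.≤-refl ≤∷ [])
    where a<c = ℕ.<-trans a<b b<c

  rank-mono : ∀ {a b} w → a ≤ b → rank a w ≤ rank b w
  rank-mono         []      a≤b = z≤n
  rank-mono {a} {b} (x ∷ w) a≤b with x ℕ.≤? a | x ℕ.≤? b
  ... | yes x≤a | yes x≤b
    rewrite List.filter-accept (ℕ._≤? a) {xs = w} x≤a | List.filter-accept (ℕ._≤? b) {xs = w} x≤b = s≤s (rank-mono w a≤b)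
  ... | no  x≰a | yes x≤b
    rewrite List.filter-reject (ℕ._≤? a) {xs = w} x≰a | List.filter-accept (ℕ._≤? b) {xs = w} x≤b = ℕ.m≤n⇒m≤1+n (rank-mono w a≤b)
  ... | yes x≤a | no  x≰b = contradiction (ℕ.≤-trans x≤a a≤b) x≰b
  ... | no  x≰a | no  x≰b
    rewrite List.filter-reject (ℕ._≤? a) {xs = w} x≰a | List.filter-reject (ℕ._≤? b) {xs = w} x≰b = rank-mono w a≤b

  rank-<⇒< : ∀ {a b} w → rank a w < rank b w → a < b
  rank-<⇒< w lt = ℕ.≰⇒> λ b≤a → ℕ.<⇒≱ lt (rank-mono w b≤a)

  red-123⁻ : ∀ w → red w ≡ 1 ∷ 2 ∷ 3 ∷ [] → ∃₂ λ a b → ∃ λ c → w ≡ a ∷ b ∷ c ∷ [] × a < b × b < c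
  red-123⁻ (a ∷ b ∷ c ∷ []) eq with r₁ , eq′ ← List.∷-injective eq with r₂ , eq″ ← List.∷-injective eq′
    with r₃ , _ ← List.∷-injective eq″ =
    a , b , c , refl , rank-<⇒< v (subst₂ _<_ (sym r₁) (sym r₂) (s≤s (s≤s z≤n)))
                     , rank-<⇒< v (subst₂ _<_ (sym r₂) (sym r₃) (s≤s (s≤s (s≤s z≤n))))
    where v = a ∷ b ∷ c ∷ []

  []∈-subsequences : ∀ w → [] ∈ subsequences w
  []∈-subsequences []      = here refl
  []∈-subsequences (a ∷ w) = ∈-++⁺ʳ (map (a ∷_) (subsequences w)) ([]∈-subsequences w)

  ∷∈-subsequences : ∀ w {a s} → a ∷ s ∈ subsequences w → ∃₂ λ u v → w ≡ u ++ a ∷ v × s ∈ subsequences v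
  ∷∈-subsequences [] (here ())
  ∷∈-subsequences (x ∷ w) s∈ with ∈-++⁻ (map (x ∷_) (subsequences w)) s∈
  ... | inj₁ s∈map with _ , s∈′ , refl ← ∈-map⁻ (x ∷_) s∈map = [] , w , refl , s∈′
  ... | inj₂ s∈′ with u , v , refl , s∈″ ← ∷∈-subsequences w s∈′ = x ∷ u , v , refl , s∈″

  subsequences-++ : ∀ u v {s} → s ∈ subsequences v → s ∈ subsequences (u ++ v)
  subsequences-++ []      v s∈ = s∈
  subsequences-++ (x ∷ u) v s∈ = ∈-++⁺ʳ (map (x ∷_) (subsequences (u ++ v))) (subsequences-++ u v s∈)

  subsequences-∷ : ∀ a w {s} → s ∈ subsequences w → a ∷ s ∈ subsequences (a ∷ w)
  subsequences-∷ a w s∈ = ∈-++⁺ˡ (∈-map⁺ (a ∷_) s∈)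

  AllPairs-tabulate : ∀ {R : ℕ → ℕ → Set} w → (∀ {b c} → b ∷ c ∷ [] ∈ subsequences w → R b c) → AllPairs R w
  AllPairs-tabulate []      h = []
  AllPairs-tabulate (a ∷ w) h = All.tabulate (λ c∈ → h (subsequences-∷ a w (∈-subsequences c∈)))
                              ∷ AllPairs-tabulate w (λ s∈ → h (subsequences-++ (a ∷ []) w s∈))
    where
    ∈-subsequences : ∀ {c w} → c ∈ w → c ∷ [] ∈ subsequences w
    ∈-subsequences {w = x ∷ w} (here refl) = subsequences-∷ x w ([]∈-subsequences w)
    ∈-subsequences {w = x ∷ w} (there c∈)  = subsequences-++ (x ∷ []) w (∈-subsequences c∈)

  avoids₁₂₃⁺ : ∀ w → Avoids (1 ∷ 2 ∷ 3 ∷ []) w → Avoids₁₂₃ w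
  avoids₁₂₃⁺ []      av = []
  avoids₁₂₃⁺ (a ∷ w) av =
    AllPairs-tabulate w (λ s∈ a<b b<c → av (lose (subsequences-∷ a w s∈) (red-123⁺ a<b b<c)))
    ∷ avoids₁₂₃⁺ w (λ occurs → av (let _ , s∈ , eq = find occurs in lose (subsequences-++ (a ∷ []) w s∈) eq))

  avoids₁₂₃⁻ : ∀ w → Avoids₁₂₃ w → Avoids (1 ∷ 2 ∷ 3 ∷ []) w
  avoids₁₂₃⁻ w av occurs with s , s∈ , eq ← find occurs
    with a , b , c , refl , a<b , b<c ← red-123⁻ s eq
    with u , v , refl , bc∈ ← ∷∈-subsequences w s∈ = after u av
    where
    pair : ∀ {R : ℕ → ℕ → Set} {v} → AllPairs R v → b ∷ c ∷ [] ∈ subsequences v → R b c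
    pair {v = v} ps bc∈ with u′ , v′ , refl , c∈ ← ∷∈-subsequences v bc∈
                        with u″ , v″ , refl , _ ← ∷∈-subsequences v′ c∈ = later u′ ps
      where
      later : ∀ u′ → AllPairs _ (u′ ++ b ∷ u″ ++ c ∷ v″) → _
      later []       (p ∷ _) = All.lookup p (∈-++⁺ʳ u″ (here refl))
      later (_ ∷ u′) (_ ∷ ps) = later u′ ps
    after : ∀ u → Avoids₁₂₃ (u ++ a ∷ v) → _
    after []      (na ∷ _) = pair na bc∈ a<b b<c
    after (_ ∷ u) (_ ∷ av) = after u av

  -- Two duplicate-free lists with the same members. The empty prefix is treated as if its minimum
  -- were `suc n`: all letters lie below it, so `NoAscentAbove (suc n)` holds vacuously.
  avoiders↭gen : ∀ n → avoiders (1 ∷ 2 ∷ 3 ∷ []) n ↭ gen n n []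
  avoiders↭gen n = ∼bag⇒↭ (unique∧set⇒bag
    (Unique.filter⁺ (avoids? _) (permutations-unique n)) (gen-unique n n [] [])
    (mk⇔ to from))
    where
    to : ∀ {w} → w ∈ avoiders (1 ∷ 2 ∷ 3 ∷ []) n → w ∈ gen n n []
    to {w} w∈ with w∈perm , av ← ∈-filter⁻ (avoids? _) {xs = permutations n} w∈ =
      gen-complete n n [] (sym (ℕ.+-identityʳ n)) [] [] p
        (AllPairs-from-All (λ b≤n n<b → contradiction b≤n (ℕ.<⇒≱ (ℕ.<-trans (ℕ.n<1+n n) n<b)))
          (All-resp-↭ (↭-sym p) (All.tabulate ∈-below⁻)))
        (avoids₁₂₃⁺ w av)
      where p = ∈-permutations⁻ n w∈perm
    from : ∀ {w} → w ∈ gen n n [] → w ∈ avoiders (1 ∷ 2 ∷ 3 ∷ []) n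
    from {w} w∈ with p , _ , av ← gen-sound n n [] (sym (ℕ.+-identityʳ n)) [] [] w∈ =
      ∈-filter⁺ (avoids? _) (∈-permutations⁺ n p) (avoids₁₂₃⁻ w av)

open Enumeration

-- Weights of words

red-321 : ∀ {p q r} → r < q → q < p → red (p ∷ q ∷ r ∷ []) ≡ 3 ∷ 2 ∷ 1 ∷ []
red-321 r<q q<p = red₃
  (ℕ.≤-refl ≤∷ ℕ.<⇒≤ q<p ≤∷ ℕ.<⇒≤ (ℕ.<-trans r<q q<p) ≤∷ [])
  (q<p >∷ ℕ.≤-refl ≤∷ ℕ.<⇒≤ r<q ≤∷ [])
  (ℕ.<-trans r<q q<p >∷ r<q >∷ ℕ.≤-refl ≤∷ [])

red-231 : ∀ {p q r} → r < p → p < q → red (p ∷ q ∷ r ∷ []) ≡ 2 ∷ 3 ∷ 1 ∷ []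
red-231 r<p p<q = red₃
  (ℕ.≤-refl ≤∷ p<q >∷ ℕ.<⇒≤ r<p ≤∷ [])
  (ℕ.<⇒≤ p<q ≤∷ ℕ.≤-refl ≤∷ ℕ.<⇒≤ (ℕ.<-trans r<p p<q) ≤∷ [])
  (r<p >∷ ℕ.<-trans r<p p<q >∷ ℕ.≤-refl ≤∷ [])

red-132 : ∀ {p q r} → p < r → r < q → red (p ∷ q ∷ r ∷ []) ≡ 1 ∷ 3 ∷ 2 ∷ []
red-132 p<r r<q = red₃
  (ℕ.≤-refl ≤∷ ℕ.<-trans p<r r<q >∷ p<r >∷ [])
  (ℕ.<⇒≤ (ℕ.<-trans p<r r<q) ≤∷ ℕ.≤-refl ≤∷ ℕ.<⇒≤ r<q ≤∷ [])
  (ℕ.<⇒≤ p<r ≤∷ r<q >∷ ℕ.≤-refl ≤∷ [])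

-- The middle letter of a valley has rank 1, while 231, 132 and 321 all have a middle letter of at
-- least 2. One statement thus excludes the three patterns.
red-valley : ∀ {p q r i j k} → q < p → q < r → red (p ∷ q ∷ r ∷ []) ≡ i ∷ suc (suc j) ∷ k ∷ [] → ⊥
red-valley q<p q<r eq = case ≡.trans (≡.sym (Rank⇒rank (q<p >∷ ℕ.≤-refl ≤∷ q<r >∷ []))) second of λ ()
  where second = List.∷-injectiveˡ (List.∷-injectiveʳ eq)

indicator : ∀ {P : Set} → Dec P → ℕ
indicator (yes _) = 1
indicator (no _)  = 0

mch-∷-≢ : ∀ γ a w → red (take (length γ) (a ∷ w)) ≢ γ → mch γ (a ∷ w) ≡ mch γ w
mch-∷-≢ γ a w ρ≢γ = ≡.cong length
  (List.filter-reject (λ s → List.≡-dec ℕ._≟_ (red (take (length γ) s)) γ) ρ≢γ)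

-- When `ρ` and `γ` are closed lists the indicator computes, so the exponents in `weight-∷` become
-- numerals.
mch-∷ : ∀ γ a w {ρ} → red (take (length γ) (a ∷ w)) ≡ ρ →
        mch γ (a ∷ w) ≡ indicator (List.≡-dec ℕ._≟_ ρ γ) ℕ.+ mch γ w
mch-∷ γ a w {ρ} ≡.refl = case-dec (List.≡-dec ℕ._≟_ ρ γ)
  where
  case-dec : (ρ≟γ : Dec (ρ ≡ γ)) → mch γ (a ∷ w) ≡ indicator ρ≟γ ℕ.+ mch γ w
  case-dec (yes ρ≡γ) = ≡.cong length
    (List.filter-accept (λ s → List.≡-dec ℕ._≟_ (red (take (length γ) s)) γ) ρ≡γ)
  case-dec (no ρ≢γ) = mch-∷-≢ γ a w ρ≢γ

des-> : ∀ {p q} w → q < p → des (p ∷ q ∷ w) ≡ suc (des (q ∷ w))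
des-> {p} {q} w q<p with q ℕ.<ᵇ p | ℕ.<⇒<ᵇ q<p
... | true | _ = ≡.refl

des-< : ∀ {p q} w → p < q → des (p ∷ q ∷ w) ≡ des (q ∷ w)
des-< {p} {q} w p<q with q ℕ.<ᵇ p | ℕ.<ᵇ⇒< q p
... | true  | q<p = contradiction p<q (ℕ.<-asym (q<p tt))
... | false | _   = ≡.refl

module Weight {c ℓ} {R : RawRing c ℓ} (isCommRing : IsCommRing R)
              (y x₁ x₂ x₃ : RawRing.Carrier R) where
  open CommutativeRing (toCommutativeRing isCommRing) hiding (rawRing; zero)
  open Paths isCommRing y x₁ x₂ x₃ using (min-weight; non-weight; paths; minima)
  open Exp semiring using (_^_; ^-homo-*)
  open AbelianGroupProperties +-abelianGroup using (x∙y⁻¹≈ε⇒x≈y)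
  open SetoidReasoning setoid
  private
    module I = IntegerSolver isCommRing
    open I using (Polynomial; con; var; _:+_; _:*_; _:-_; _:^_)

  weight : Word → Carrier
  weight σ = y  ^ des σ
           * x₁ ^ mch (2 ∷ 3 ∷ 1 ∷ []) σ
           * x₂ ^ mch (1 ∷ 3 ∷ 2 ∷ []) σ
           * x₃ ^ mch (3 ∷ 2 ∷ 1 ∷ []) σ

  weight-step : ∀ {σ τ} d i j k →
                des τ ≡ d ℕ.+ des σ →
                mch (2 ∷ 3 ∷ 1 ∷ []) τ ≡ i ℕ.+ mch (2 ∷ 3 ∷ 1 ∷ []) σ →
                mch (1 ∷ 3 ∷ 2 ∷ []) τ ≡ j ℕ.+ mch (1 ∷ 3 ∷ 2 ∷ []) σ →
                mch (3 ∷ 2 ∷ 1 ∷ []) τ ≡ k ℕ.+ mch (3 ∷ 2 ∷ 1 ∷ []) σ →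
                weight τ ≈ y ^ d * x₁ ^ i * x₂ ^ j * x₃ ^ k * weight σ
  weight-step {σ} {τ} d i j k d≡ i≡ j≡ k≡ rewrite d≡ | i≡ | j≡ | k≡ = begin
    y ^ (d ℕ.+ des σ) * x₁ ^ (i ℕ.+ i′) * x₂ ^ (j ℕ.+ j′) * x₃ ^ (k ℕ.+ k′)
      ≈⟨ *-cong (*-cong (*-cong (^-homo-* y d (des σ)) (^-homo-* x₁ i i′)) (^-homo-* x₂ j j′)) (^-homo-* x₃ k k′) ⟩
    y ^ d * y ^ des σ * (x₁ ^ i * x₁ ^ i′) * (x₂ ^ j * x₂ ^ j′) * (x₃ ^ k * x₃ ^ k′)
      ≈⟨ *-cong (*-cong (*-interchange _ _ _ _) refl) refl ⟩
    y ^ d * x₁ ^ i * (y ^ des σ * x₁ ^ i′) * (x₂ ^ j * x₂ ^ j′) * (x₃ ^ k * x₃ ^ k′)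
      ≈⟨ *-cong (*-interchange _ _ _ _) refl ⟩
    y ^ d * x₁ ^ i * x₂ ^ j * (y ^ des σ * x₁ ^ i′ * x₂ ^ j′) * (x₃ ^ k * x₃ ^ k′)
      ≈⟨ *-interchange _ _ _ _ ⟩
    y ^ d * x₁ ^ i * x₂ ^ j * x₃ ^ k * weight σ ∎
    where
    open CommutativeSemigroupProperties *-commutativeSemigroup using () renaming (interchange to *-interchange)
    i′ = mch (2 ∷ 3 ∷ 1 ∷ []) σ
    j′ = mch (1 ∷ 3 ∷ 2 ∷ []) σ
    k′ = mch (3 ∷ 2 ∷ 1 ∷ []) σ

  private
    yᵖ x₁ᵖ x₂ᵖ x₃ᵖ one : Polynomial 4
    yᵖ  = var 0F
    x₁ᵖ = var 1F
    x₂ᵖ = var 2F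
    x₃ᵖ = var 3F
    one = con (+ 1)

    monomial : ℕ → ℕ → ℕ → ℕ → Polynomial 4
    monomial d i j k = yᵖ :^ d :* x₁ᵖ :^ i :* x₂ᵖ :^ j :* x₃ᵖ :^ k

    simplify : (p q : Polynomial 4) → I.normalise (p :- q) ≡ I.normalise (con (+ 0)) →
               I.⟦ p ⟧ (y ∷ x₁ ∷ x₂ ∷ x₃ ∷ []) ≈ I.⟦ q ⟧ (y ∷ x₁ ∷ x₂ ∷ x₃ ∷ [])
    simplify p q p≡q = x∙y⁻¹≈ε⇒x≈y _ _ (I.identity (p :- q) p≡q _)

  weight-∷ : ∀ a w d {ρ} → des (a ∷ w) ≡ d ℕ.+ des w → red (take 3 (a ∷ w)) ≡ ρ →
             weight (a ∷ w) ≈ y ^ d * x₁ ^ indicator (List.≡-dec ℕ._≟_ ρ (2 ∷ 3 ∷ 1 ∷ []))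
                                    * x₂ ^ indicator (List.≡-dec ℕ._≟_ ρ (1 ∷ 3 ∷ 2 ∷ []))
                                    * x₃ ^ indicator (List.≡-dec ℕ._≟_ ρ (3 ∷ 2 ∷ 1 ∷ [])) * weight w
  weight-∷ a w d {ρ} d≡ ρ≡ = weight-step {w} {a ∷ w} d _ _ _ d≡
    (mch-∷ (2 ∷ 3 ∷ 1 ∷ []) a w ρ≡) (mch-∷ (1 ∷ 3 ∷ 2 ∷ []) a w ρ≡) (mch-∷ (3 ∷ 2 ∷ 1 ∷ []) a w ρ≡)

  weight-∷-≢ : ∀ a w d → des (a ∷ w) ≡ d ℕ.+ des w → (∀ {i j k} → red (take 3 (a ∷ w)) ≢ i ∷ suc (suc j) ∷ k ∷ []) →
               weight (a ∷ w) ≈ y ^ d * x₁ ^ 0 * x₂ ^ 0 * x₃ ^ 0 * weight w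
  weight-∷-≢ a w d d≡ ≢ = weight-step {w} {a ∷ w} d 0 0 0 d≡
    (mch-∷-≢ (2 ∷ 3 ∷ 1 ∷ []) a w ≢) (mch-∷-≢ (1 ∷ 3 ∷ 2 ∷ []) a w ≢) (mch-∷-≢ (3 ∷ 2 ∷ 1 ∷ []) a w ≢)

  weight-321 : ∀ p q r w → r < q → q < p → weight (p ∷ q ∷ r ∷ w) ≈ x₃ * y * weight (q ∷ r ∷ w)
  weight-321 p q r w r<q q<p = trans
    (weight-∷ p (q ∷ r ∷ w) 1 (des-> (r ∷ w) q<p) (red-321 r<q q<p))
    (*-congʳ (simplify (monomial 1 0 0 1) (x₃ᵖ :* yᵖ) ≡.refl))

  weight-231 : ∀ p q r w → r < p → p < q → weight (p ∷ q ∷ r ∷ w) ≈ x₁ * weight (q ∷ r ∷ w)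
  weight-231 p q r w r<p p<q = trans
    (weight-∷ p (q ∷ r ∷ w) 0 (des-< (r ∷ w) p<q) (red-231 r<p p<q))
    (*-congʳ (simplify (monomial 0 1 0 0) x₁ᵖ ≡.refl))

  weight-132 : ∀ p q r w → p < r → r < q → weight (p ∷ q ∷ r ∷ w) ≈ x₂ * weight (q ∷ r ∷ w)
  weight-132 p q r w p<r r<q = trans
    (weight-∷ p (q ∷ r ∷ w) 0 (des-< (r ∷ w) (ℕ.<-trans p<r r<q)) (red-132 p<r r<q))
    (*-congʳ (simplify (monomial 0 0 1 0) x₂ᵖ ≡.refl))

  weight-valley : ∀ p q r w → q < p → q < r → weight (p ∷ q ∷ r ∷ w) ≈ y * weight (q ∷ r ∷ w)
  weight-valley p q r w q<p q<r = trans
    (weight-∷-≢ p (q ∷ r ∷ w) 1 (des-> (r ∷ w) q<p) (red-valley q<p q<r))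
    (*-congʳ (simplify (monomial 1 0 0 0) yᵖ ≡.refl))

  weight-[] : weight [] ≈ 1#
  weight-[] = simplify (monomial 0 0 0 0) one ≡.refl

  weight-[q] : ∀ q → weight (q ∷ []) ≈ 1#
  weight-[q] q = trans (weight-∷-≢ q [] 0 ≡.refl λ ())
    (trans (*-congˡ weight-[]) (simplify (monomial 0 0 0 0 :* one) one ≡.refl))

  weight-> : ∀ p q → q < p → weight (p ∷ q ∷ []) ≈ y
  weight-> p q q<p = trans (weight-∷-≢ p (q ∷ []) 1 (des-> [] q<p) λ ())
    (trans (*-congˡ (weight-[q] q)) (simplify (monomial 1 0 0 0 :* one) yᵖ ≡.refl))

  weight-< : ∀ p q → p < q → weight (p ∷ q ∷ []) ≈ 1#
  weight-< p q p<q = trans (weight-∷-≢ p (q ∷ []) 0 (des-< [] p<q) λ ())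
    (trans (*-congˡ (weight-[q] q)) (simplify (monomial 0 0 0 0 :* one) one ≡.refl))

  prefix : Context → ℕ → ℕ → Word → Word
  prefix ∅  p q w = w
  prefix m₁ p q w = q ∷ w
  prefix _  p q w = p ∷ q ∷ w

  -- What survives of `State` while `genMin` passes over candidates: `m` drops although no letter is
  -- placed, so equations with `suc m` are lost. The inequalities left determine the patterns that a
  -- new minimum completes.
  Above : Context → ℕ → ℕ → ℕ → Set
  Above ∅  p q m = ⊤
  Above m₁ p q m = m < q
  Above mn p q m = m < p × p < q
  Above _  p q m = m < q × q < p

  State : Context → ℕ → ℕ → ℕ → List ℕ → Set
  State ∅  p q m B = B ≡ []
  State m₁ p q m B = q ≡ suc m
  State □m p q m B = q ≡ suc m × q < p
  State mn p q m B = p ≡ suc m × p < q × All (_< q) B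
  State nn p q m B = suc m < q × q < p × All (_< q) B

  State⇒Above : ∀ s {p q m B} → State s p q m B → Above s p q m
  State⇒Above ∅  _                 = tt
  State⇒Above m₁ ≡.refl            = ℕ.≤-refl
  State⇒Above □m (≡.refl , q<p)    = ℕ.≤-refl , q<p
  State⇒Above mn (≡.refl , p<q , _) = ℕ.≤-refl , p<q
  State⇒Above nn (m<q , q<p , _)   = ℕ.<-trans (ℕ.n<1+n _) m<q , q<p

  Above-pred : ∀ s {p q m} → Above s p q (suc m) → Above s p q m
  Above-pred ∅  _           = tt
  Above-pred m₁ m<q         = ℕ.<-trans (ℕ.n<1+n _) m<q
  Above-pred □m (m<q , q<p) = ℕ.<-trans (ℕ.n<1+n _) m<q , q<p
  Above-pred mn (m<p , p<q) = ℕ.<-trans (ℕ.n<1+n _) m<p , p<q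
  Above-pred nn (m<q , q<p) = ℕ.<-trans (ℕ.n<1+n _) m<q , q<p

  State-min : ∀ s {p q a B} → Above s p q (suc a) → State (after-min s) q (suc a) a B
  State-min ∅  _           = ≡.refl
  State-min m₁ a<q         = ≡.refl , a<q
  State-min □m (a<q , _)   = ≡.refl , a<q
  State-min mn (a<p , p<q) = ≡.refl , ℕ.<-trans a<p p<q
  State-min nn (a<q , _)   = ≡.refl , a<q

  State-non : ∀ s {p q m x B} → State s p q m (x ∷ B) → suc m < x → All (_< x) B →
              State (after-non s) q x m B
  State-non m₁ ≡.refl                   m<x B<x = ≡.refl , m<x , B<x
  State-non □m (≡.refl , _)             m<x B<x = ≡.refl , m<x , B<x
  State-non mn (≡.refl , _ , x<q ∷ _)   m<x B<x = m<x , x<q , B<x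
  State-non nn (_ , _ , x<q ∷ _)        m<x B<x = m<x , x<q , B<x

  -- last-weight is the weight of the remembered letters alone; the factors are
  -- what is paid for forgetting the older one when a letter is appended.
  last-weight min-factor non-factor : Context → Carrier
  last-weight ∅  = 1#
  last-weight m₁ = 1#
  last-weight □m = y
  last-weight mn = 1#
  last-weight nn = y
  min-factor □m = x₃ * y
  min-factor mn = x₁
  min-factor nn = x₃ * y
  min-factor _  = 1#
  non-factor □m = y
  non-factor mn = x₂
  non-factor nn = x₃ * y
  non-factor _  = 1#

  min-factor-eq : ∀ s → min-factor s * last-weight (after-min s) ≈ last-weight s * min-weight s
  min-factor-eq ∅  = refl
  min-factor-eq m₁ = refl
  min-factor-eq □m = *-comm _ _
  min-factor-eq mn = sym (*-identityˡ _)
  min-factor-eq nn = *-comm _ _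

  non-factor-eq : ∀ s → non-factor s * last-weight (after-non s) ≈ last-weight s * non-weight s
  non-factor-eq ∅  = refl
  non-factor-eq m₁ = refl
  non-factor-eq □m = refl
  non-factor-eq mn = sym (*-identityˡ _)
  non-factor-eq nn = *-comm _ _

  weight-end : ∀ s {p q m B} → State s p q m B → weight (prefix s p q []) ≈ last-weight s
  weight-end ∅          _             = weight-[]
  weight-end m₁ {q = q} _             = weight-[q] q
  weight-end □m {p} {q} (_ , q<p)     = weight-> p q q<p
  weight-end mn {p} {q} (_ , p<q , _) = weight-< p q p<q
  weight-end nn {p} {q} (_ , q<p , _) = weight-> p q q<p

  weight-min : ∀ s {p q a} w → Above s p q (suc a) →
               weight (prefix s p q (suc a ∷ w)) ≈ min-factor s * weight (prefix (after-min s) q (suc a) w)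
  weight-min ∅          w _           = sym (*-identityˡ _)
  weight-min m₁         w _           = sym (*-identityˡ _)
  weight-min □m {p} {q} w (a<q , q<p) = weight-321 p q _ w a<q q<p
  weight-min mn {p} {q} w (a<p , p<q) = weight-231 p q _ w a<p p<q
  weight-min nn {p} {q} w (a<q , q<p) = weight-321 p q _ w a<q q<p

  weight-non : ∀ s {p q m x B} w → State s p q m (x ∷ B) → suc m < x →
               weight (prefix s p q (x ∷ w)) ≈ non-factor s * weight (prefix (after-non s) q x w)
  weight-non m₁         w _                          m<x = sym (*-identityˡ _)
  weight-non □m {p} {q} w (≡.refl , q<p)             m<x = weight-valley p q _ w q<p m<x
  weight-non mn {p} {q} w (≡.refl , _ , x<q ∷ _)     m<x = weight-132 p q _ w m<x x<q
  weight-non nn {p} {q} w (_ , q<p , x<q ∷ _)        m<x = weight-321 p q _ w x<q q<p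

  -- Summing the weights over the enumeration

  total : (Word → Carrier) → List Word → Carrier
  total f ws = foldr _+_ 0# (map f ws)

  total-++ : ∀ f ws ws′ → total f (ws ++ ws′) ≈ total f ws + total f ws′
  total-++ f []       ws′ = sym (+-identityˡ _)
  total-++ f (w ∷ ws) ws′ = trans (+-congˡ (total-++ f ws ws′)) (sym (+-assoc _ _ _))

  total-map : ∀ {f g} c a → (∀ w → f (a ∷ w) ≈ c * g w) → ∀ ws → total f (map (a ∷_) ws) ≈ c * total g ws
  total-map c a f≈cg []       = sym (zeroʳ c)
  total-map c a f≈cg (w ∷ ws) = trans (+-cong (f≈cg w) (total-map c a f≈cg ws)) (sym (distribˡ c _ _))

  total-↭ : ∀ f {ws ws′} → ws ↭ ws′ → total f ws ≈ total f ws′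
  total-↭ f p = SetoidPermutation.foldr-commMonoid setoid +-isCommutativeMonoid (↭⇒↭ₛ′ isEquivalence (map⁺ f p))

  regroup : ∀ {a b c d e} → a * b ≈ c * d → a * (b * e) ≈ c * (d * e)
  regroup eq = trans (sym (*-assoc _ _ _)) (trans (*-congʳ eq) (*-assoc _ _ _))

  mutual
    -- The remembered letters stay in front of each completion because descents and triples may
    -- straddle the boundary. On the right the actual letters are gone: of `B` only the length
    -- matters.
    total-gen : ∀ s p q k m B → State s p q m B → Decreasing B → All (suc m <_) B →
                total (weight ∘ prefix s p q) (gen k m B) ≈ last-weight s * paths s k m (length B)
    total-gen s p q zero    m []      st dec low =
      trans (+-identityʳ _) (trans (weight-end s st) (sym (*-identityʳ _)))
    total-gen s p q zero    m (x ∷ B) st dec low = sym (zeroʳ _)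
    total-gen s p q (suc k) m []      st dec low = total-genMin s p q k m [] (State⇒Above s st) [] []
    total-gen s p q (suc k) m (x ∷ B) st (x>B ∷ dec) low@(m<x ∷ low-B) = begin
      total (weight ∘ prefix s p q) (genMin k m (x ∷ B) ++ map (x ∷_) (gen k m B))
        ≈⟨ total-++ _ (genMin k m (x ∷ B)) _ ⟩
      total (weight ∘ prefix s p q) (genMin k m (x ∷ B)) + total (weight ∘ prefix s p q) (map (x ∷_) (gen k m B))
        ≈⟨ +-cong (total-genMin s p q k m (x ∷ B) (State⇒Above s st) (x>B ∷ dec) (weaken-< low))
                  (total-map (non-factor s) x (λ w → weight-non s w st m<x) (gen k m B)) ⟩
      last-weight s * (min-weight s * minima (after-min s) k m (suc (length B)))
        + non-factor s * total (weight ∘ prefix (after-non s) q x) (gen k m B)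
        ≈⟨ +-congˡ (*-congˡ (total-gen (after-non s) q x k m B (State-non s st m<x x>B) dec low-B)) ⟩
      last-weight s * (min-weight s * minima (after-min s) k m (suc (length B)))
        + non-factor s * (last-weight (after-non s) * paths (after-non s) k m (length B))
        ≈⟨ +-congˡ (regroup (non-factor-eq s)) ⟩
      last-weight s * (min-weight s * minima (after-min s) k m (suc (length B)))
        + last-weight s * (non-weight s * paths (after-non s) k m (length B))
        ≈⟨ distribˡ _ _ _ ⟨
      last-weight s * paths s (suc k) m (suc (length B)) ∎

    total-genMin : ∀ s p q k m B → Above s p q m → Decreasing B → All (m <_) B →
                   total (weight ∘ prefix s p q) (genMin k m B)
                     ≈ last-weight s * (min-weight s * minima (after-min s) k m (length B))
    total-genMin s p q k zero    B ab dec low = sym (trans (*-congˡ (zeroʳ _)) (zeroʳ _))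
    total-genMin s p q k (suc a) B ab dec low = begin
      total (weight ∘ prefix s p q) (map (suc a ∷_) (gen k a B) ++ genMin k a (B ∷ʳ suc a))
        ≈⟨ total-++ _ (map (suc a ∷_) (gen k a B)) _ ⟩
      total (weight ∘ prefix s p q) (map (suc a ∷_) (gen k a B)) + total (weight ∘ prefix s p q) (genMin k a (B ∷ʳ suc a))
        ≈⟨ +-cong (total-map (min-factor s) (suc a) (λ w → weight-min s w ab) (gen k a B))
                  (total-genMin s p q k a (B ∷ʳ suc a) (Above-pred s ab) (Decreasing-∷ʳ dec low) (low-∷ʳ low)) ⟩
      min-factor s * total (weight ∘ prefix (after-min s) q (suc a)) (gen k a B)
        + last-weight s * (min-weight s * minima (after-min s) k a (length (B ∷ʳ suc a)))
        ≈⟨ +-cong (trans (*-congˡ (total-gen (after-min s) q (suc a) k a B (State-min s ab) dec low))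
                         (regroup (min-factor-eq s)))
                  (reflexive (≡.cong (λ b → last-weight s * (min-weight s * minima (after-min s) k a b))
                    (≡.trans (List.length-++ B) (ℕ.+-comm (length B) 1)))) ⟩
      last-weight s * (min-weight s * paths (after-min s) k a (length B))
        + last-weight s * (min-weight s * minima (after-min s) k a (suc (length B)))
        ≈⟨ trans (*-congˡ (distribˡ _ _ _)) (distribˡ _ _ _) ⟨
      last-weight s * (min-weight s * minima (after-min s) k (suc a) (length B)) ∎

  total-avoiders : ∀ n → total weight (avoiders (1 ∷ 2 ∷ 3 ∷ []) n) ≈ paths ∅ n n 0
  total-avoiders n = begin
    total weight (avoiders (1 ∷ 2 ∷ 3 ∷ []) n)  ≈⟨ total-↭ weight (avoiders↭gen n) ⟩
    total weight (gen n n [])                   ≈⟨ total-gen ∅ 0 0 n n [] ≡.refl [] [] ⟩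
    1# * paths ∅ n n 0                          ≈⟨ *-identityˡ _ ⟩
    paths ∅ n n 0                               ∎

-- Specialisation to the coefficient ring ℚ[y,x₁,x₂,x₃]

open import Defs

private
  module 𝕊   = CommutativeRing (toCommutativeRing series-isCommRing)
  module Gen = Paths ℚ[y,x₁,x₂,x₃]-isCommRing Coefficients.y Coefficients.x₁ Coefficients.x₂ Coefficients.x₃
  module Sol = Solution ℚ[y,x₁,x₂,x₃]-isCommRing Coefficients.y Coefficients.x₁ Coefficients.x₂ Coefficients.x₃
    (λ {p} → PolynomialRing.X-nonZeroDivisor ℚ[y,x₁,x₂]-isCommRing {p})

x₃[x₂-x₁]≉0 : Coefficients.x₃ Coefficients.* (Coefficients.x₂ Coefficients.+ Coefficients.- Coefficients.x₁)
               Coefficients.≉ Coefficients.0#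
-- The indices are the exponents of `x₃`, `x₂`, `x₁`, `y`, outermost variable first: the coefficient
-- of `x₃ * x₁` is -1.
x₃[x₂-x₁]≉0 eq with () ← eq 1 0 1 0

D≉0 : ∀ A₀ → D A₀ ≉ 0#
D≉0 A₀ D≈0 = x₃[x₂-x₁]≉0 (Sol.denominator-constant-term A₀ 0# {D A₀} ≡.refl D≈0)

A≈paths : A ≈ Gen.pathsˢ ∅ 0
A≈paths = Weight.total-avoiders ℚ[y,x₁,x₂,x₃]-isCommRing
  Coefficients.y Coefficients.x₁ Coefficients.x₂ Coefficients.x₃

theorem7 : (A₀ : Carrier) → IsA₀ A₀ → A ≈ N A₀ ÷ D A₀
theorem7 A₀ (Q , (_ , Q-eq) , A₀-eq) = D≉0 A₀ ,
  𝕊.trans {A * D A₀} {Gen.pathsˢ ∅ 0 * D A₀} {N A₀} (𝕊.*-congʳ {D A₀} {A} {Gen.pathsˢ ∅ 0} A≈paths)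
    (Sol.paths*denominator≈numerator A₀ Q
      {Q * (1# - t * x₃ * y * A₀)} {t ^ 3 * x₂ * x₃ * y ^ 2 * A₀ ^ 3}
      {1# + t * x₃ * y * A₀ + t ^ 2 * x₁ * y * A₀ ^ 2 + Q} {D A₀} {N A₀}
      ≡.refl ≡.refl ≡.refl ≡.refl ≡.refl Q-eq A₀-eq)
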